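{- Define integers $g_n(i,j)$ ($n\ge1$, $i,j\in\mathbb Z$) by $g_1(1,0)=1$, $g_1(i,j)=0$ for $(i,j)\ne(1,0)$, and $g_{n+1}(i,j)=g_n(i-1,j)+4(1+i)g_n(i+1,j-1)+2j\, g_n(i,j)+4(n+2-i-2j)g_n(i,j-1)$. Then for $n\ge1$, $$g_n(i,j)=\#\{\pi\in\mathcal D_n^B:\ \mathrm{single}(\pi)=i,\ \mathrm{wexc}(\pi)=j,\ \mathrm{cda}(\pi)=0\}.$$
   Context: $B_n$ is the group of bijections $\pi$ of $\pm[n]$ with $\pi(-i)=-\pi(i)$; $\mathcal D_n^B$ is the set of $\pi\in B_n$ with no $i\in[n]$ such that $\pi(i)=i$. For $\pi\in\mathcal D_n^B$: $\mathrm{wexc}(\pi)=\#\{i\in[n]:\pi(|\pi(i)|)>\pi(i)\}$ and $\mathrm{single}(\pi)=\#\{i\in[n]:\pi(i)=-i\}$. Write $\pi$ in cycle form: a cycle $(c_1,\dots,c_m)$ of signed entries means $\pi(|c_k|)=c_{k+1}$ (indices mod $m$), the cycles corresponding to the cycles of $i\mapsto|\pi(i)|$. In the standard cycle decomposition each cycle is written with its largest entry (in the usual order of integers) last. An entry $c_k$ with $1<k<m$ of a cycle $(c_1,\dots,c_m)$ is a cycle double ascent if $c_{k-1}<c_k<c_{k+1}$; $\mathrm{cda}(\pi)$ is the number of cycle double ascents of $\pi$ in its standard cycle decomposition. -}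

module Defs where

open import Data.Bool using (Bool; true; false; if_then_else_; not; _∧_)
open import Data.Nat as ℕ using (ℕ; zero; suc)
open import Data.Integer as ℤ using (ℤ; +_; -[1+_])
open import Data.Fin as Fin using (Fin; toℕ)
open import Data.Vec as Vec using (Vec; lookup)
open import Data.List as List using (List; []; _∷_; length; filterᵇ; allFin; upTo; map; foldr; take; drop; _++_; takeWhileᵇ; deduplicate)
open import Data.Bool.ListAction using (all)
open import Data.Nat.ListAction using (sum)
import Data.List.Properties as ListP
open import Data.Product using (Σ; _×_; _,_; proj₁; proj₂)
open import Relation.Nullary.Decidable using (does; ⌊_⌋)
open import Relation.Binary.PropositionalEquality using (_≡_)

-- The recursively defined integers g_n(i,j), n ≥ 1.
-- g 0 is an unused dummy (set to 0); g (suc 0) is g_1.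

g : ℕ → ℤ → ℤ → ℤ
g zero i j = + 0
g (suc zero) i j = if ⌊ i ℤ.≟ + 1 ⌋ ∧ ⌊ j ℤ.≟ + 0 ⌋ then + 1 else + 0
g (suc (suc k)) i j =
  let n = suc k in
  g n (i ℤ.- + 1) j
  ℤ.+ (+ 4) ℤ.* (+ 1 ℤ.+ i) ℤ.* g n (i ℤ.+ + 1) (j ℤ.- + 1)
  ℤ.+ (+ 2) ℤ.* j ℤ.* g n i j
  ℤ.+ (+ 4) ℤ.* (+ (n ℕ.+ 2) ℤ.- i ℤ.- (+ 2) ℤ.* j) ℤ.* g n i (j ℤ.- + 1)

-- Signed permutations.
-- A signed entry (s , k) : Bool × Fin n stands for the integer
-- +(k+1) if s = false and -(k+1) if s = true.
-- An array π : Vec (Bool × Fin n) n encodes the map i+1 ↦ val (lookup π i)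
-- on [n], extended to ±[n] by π(-i) = -π(i).

SEntry : ℕ → Set
SEntry n = Bool × Fin n

val : ∀ {n} → SEntry n → ℤ
val (false , k) = + suc (toℕ k)
val (true  , k) = -[1+ toℕ k ]

SArr : ℕ → Set
SArr n = Vec (SEntry n) n

πv : ∀ {n} → SArr n → Fin n → ℤ
πv π i = val (lookup π i)

absMap : ∀ {n} → SArr n → Fin n → Fin n
absMap π i = proj₂ (lookup π i)

-- π is an element of B_n iff i ↦ |π(i)| is a bijection of [n]
-- (equivalently, injective on the finite set [n]).
isBn : ∀ {n} → SArr n → Bool
isBn {n} π = all (λ i → all (λ j → not ⌊ absMap π i Fin.≟ absMap π j ⌋ Data.Bool.∨ ⌊ i Fin.≟ j ⌋) (allFin n)) (allFin n)
  where import Data.Bool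

isDerangement : ∀ {n} → SArr n → Bool
isDerangement {n} π = all (λ i → not ⌊ πv π i ℤ.≟ + suc (toℕ i) ⌋) (allFin n)

countᶠ : ∀ {n} → (Fin n → Bool) → ℕ
countᶠ {n} p = length (filterᵇ p (allFin n))

single : ∀ {n} → SArr n → ℕ
single π = countᶠ (λ i → ⌊ πv π i ℤ.≟ -[1+ toℕ i ] ⌋)

wexc : ∀ {n} → SArr n → ℕ
wexc π = countᶠ (λ i → ⌊ πv π i ℤ.<? πv π (absMap π i) ⌋)

iter : ∀ {n} → (Fin n → Fin n) → ℕ → Fin n → Fin n
iter f zero x = x
iter f (suc k) x = f (iter f k x)

stepsTo : ∀ {n} → (Fin n → Fin n) → ℕ → Fin n → Fin n → ℕ
stepsTo f zero a x = 0
stepsTo f (suc fuel) a x = if ⌊ f x Fin.≟ a ⌋ then 1 else suc (stepsTo f fuel a (f x))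

cycLen : ∀ {n} → SArr n → Fin n → ℕ
cycLen {n} π a = stepsTo (absMap π) n a a

-- the cycle through a, written as a list of signed entries
-- (π(a), π(|π(a)|), ...), i.e. c_{k+1} = π(|c_k|)
cycFrom : ∀ {n} → SArr n → Fin n → List ℤ
cycFrom π a = map (λ k → πv π (iter (absMap π) k a)) (upTo (cycLen π a))

maxList : List ℤ → ℤ → ℤ
maxList xs d = foldr ℤ._⊔_ d xs

rotateMaxLast : List ℤ → List ℤ
rotateMaxLast [] = []
rotateMaxLast (x ∷ xs) =
  let c = x ∷ xs
      M = maxList xs x
      r = length (takeWhileᵇ (λ e → not ⌊ e ℤ.≟ M ⌋) c)
  in drop (suc r) c ++ take (suc r) c

stdCycle : ∀ {n} → SArr n → Fin n → List ℤ
stdCycle π a = rotateMaxLast (cycFrom π a)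

stdCycles : ∀ {n} → SArr n → List (List ℤ)
stdCycles {n} π = deduplicate (ListP.≡-dec ℤ._≟_) (map (stdCycle π) (allFin n))

cdaCycle : List ℤ → ℕ
cdaCycle (x ∷ y ∷ z ∷ rest) =
  (if ⌊ x ℤ.<? y ⌋ ∧ ⌊ y ℤ.<? z ⌋ then 1 else 0) ℕ.+ cdaCycle (y ∷ z ∷ rest)
cdaCycle _ = 0

cda : ∀ {n} → SArr n → ℕ
cda π = sum (map cdaCycle (stdCycles π))

DerSet : ℕ → ℤ → ℤ → Set
DerSet n i j =
  Σ (SArr n) λ π →
    (isBn π ∧ isDerangement π) ≡ true
    × + single π ≡ i
    × + wexc π ≡ j
    × cda π ≡ 0

{-# OPTIONS --safe #-}

-- Signed permutations of [n+1] arise from those of [n] by adjoining ±(n+1) either as a fixed point or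
-- inside a cycle, right after any chosen node. As ±(n+1) is extremal in the order of the integers, an
-- insertion changes the kind (valley, peak, double ascent, double descent, fixed point) of exactly one old
-- node. Counting all signed permutations by the numbers p, i of positive and negative fixed points, v of
-- valleys (equal to the number of peaks), d of double descents and u of double ascents gives a recurrence
-- in which p, i and d, u play symmetric roles; hence the count is
--   C(p+i, p) · C(d+u, u) · b n (p+i) v (d+u)
-- for some b. This trades the permutations with one double ascent or one positive fixed point, which
-- insertion may produce, for derangements without double ascents, and the recurrence of b at p = u = 0
-- becomes that of g, with d = n − i − 2v.

module Submission where

open import Defs
open import Axiom.UniquenessOfIdentityProofs using (module Decidable⇒UIP)
open import Data.Bool.Base using (Bool; true; false; not; if_then_else_; _∧_; _∨_)
open import Data.Bool.ListAction using (all)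
import Data.Bool.Properties as Bool
open import Data.Empty using (⊥; ⊥-elim)
open import Data.Fin using (Fin; zero; suc; toℕ; inject₁; fromℕ; remQuot)
open import Data.Fin.Properties using (_≟_; any?; pigeonhole; <⇒notInjective; toℕ<n; toℕ-inject₁; toℕ-fromℕ; toℕ-injective; inject₁-injective; fromℕ≢inject₁; +↔⊎)
open import Data.Fin.Relation.Unary.Top using (view; ‵fromℕ; ‵inject₁)
open import Data.Integer as ℤ using (ℤ; +_; -[1+_])
import Data.Integer.Properties as ℤ
import Data.Integer.Tactic.RingSolver as IntRing
open import Data.List.Base as List using (List; []; _∷_; _++_; length; map; take; drop; takeWhileᵇ; applyUpTo; upTo; allFin)
open import Data.List.Membership.Propositional using (_∈_)
open import Data.List.Membership.Propositional.Properties using (foldr-selective; ∈-deduplicate⁺; ∈-deduplicate⁻; ∈-map⁺; ∈-map⁻; ∈-allFin)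
import Data.List.Properties as List
open import Data.List.Relation.Unary.Any using (here; there)
open import Data.Nat as ℕ using (ℕ; zero; suc; _+_; _*_; _∸_; _≡ᵇ_; _≤_)
import Data.Nat.ListAction as ListAction
import Data.Nat.Properties as ℕ
open import Data.Nat.Tactic.RingSolver using (solve-∀)
open import Data.Product using (Σ; ∃; ∃₂; _×_; _,_; proj₁; proj₂)
open import Data.Product.Function.Dependent.Propositional using (Σ-↔)
open import Data.Sum.Base using (_⊎_; inj₁; inj₂)
open import Data.Sum.Function.Propositional using (_⊎-↔_)
open import Data.Vec.Base using (lookup; tabulate)
open import Data.Vec.Functional using (updateAt)
open import Data.Vec.Functional.Properties using (updateAt-updates; updateAt-minimal)
open import Data.Vec.Properties using (lookup∘tabulate; tabulate∘lookup; tabulate-cong)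
open import Function.Base using (_∘_; id; const)
open import Function.Bundles using (_↔_; mk↔ₛ′)
open import Function.Definitions using (Injective)
open import Function.Properties.Inverse using (↔-refl; ↔-trans)
open import Relation.Nullary using (¬_; Dec; yes; no; does; contradiction)
open import Relation.Nullary.Decidable using (⌊_⌋)
open import Relation.Binary.PropositionalEquality
open import Algebra.Properties.CommutativeMonoid.Sum ℕ.+-0-commutativeMonoid using (sum; sum-cong-≗; ∑-distrib-+; sum-init-last; sum-replicate-zero)
open import Algebra.Properties.Semiring.Sum ℕ.+-*-semiring using (*-distribˡ-sum)

-- The statistics can be read off from kinds because they are cyclic. The comparisons counted by
-- `wexc` run around whole cycles, so `wexc` is v + u. A standard cycle ends with its maximum, so
-- the cut lies between two nodes neither of which is a double ascent; hence `cda` vanishes iff u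
-- does. The symmetry has a local reason. Next to a positive letter a fixed point turns into a
-- valley, next to a negative one into a peak, whatever its own sign; a double ascent or double
-- descent turns in the same way. Conversely, each peak and each valley offers one insertion that
-- makes it a double descent and one that makes it a double ascent. The 4 in g is 2 · 2. One factor
-- is the sign of the new letter. The other comes from (p+1) · C(p+1+i, p+1) = (i+1) · C(p+i+1, p) =
-- (p+i+1) · C(p+i, p): at p = 0, the predecessors with one positive fixed point contribute as much
-- as those with one more negative fixed point, and likewise for u and d. The coefficient n + 2 - i
-- - 2j is d + 1 for permutations of size n + 1.

private variable
  n : ℕ
  A : Set

-- Codes of signed permutations

snoc : (Fin n → A) → A → Fin (suc n) → A
snoc {zero}  f a _       = a
snoc {suc n} f a zero    = f zero
snoc {suc n} f a (suc i) = snoc (f ∘ suc) a i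

snoc-inject₁ : (f : Fin n → A) (a : A) (i : Fin n) → snoc f a (inject₁ i) ≡ f i
snoc-inject₁ f a zero    = refl
snoc-inject₁ f a (suc i) = snoc-inject₁ (f ∘ suc) a i

snoc-fromℕ : (f : Fin n → A) (a : A) → snoc f a (fromℕ n) ≡ a
snoc-fromℕ {zero}  f a = refl
snoc-fromℕ {suc n} f a = snoc-fromℕ (f ∘ suc) a

-- As in SEntry, the sign true is negative. fix s c adjoins ±(n+1) as a fixed point; ins x s c inserts it
-- into the cycle of the node x, right after x.
data Code : ℕ → Set where
  nil : Code 0
  fix : Bool → Code n → Code (suc n)
  ins : Fin n → Bool → Code n → Code (suc n)

raise : SEntry n → SEntry (suc n)
raise (s , y) = s , inject₁ y

ent : Code n → Fin n → SEntry n
ent (fix s c)   = snoc (raise ∘ ent c) (s , fromℕ _)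
ent (ins x s c) = snoc (updateAt (raise ∘ ent c) x (const (s , fromℕ _))) (raise (ent c x))

perm : Code n → Fin n → Fin n
perm c = proj₂ ∘ ent c

-- Indexed by the letter and not by the array position that holds it: an insertion redirects
-- positions, but never changes the sign of an old letter.
sgn : Code n → Fin n → Bool
sgn (fix s c)   = snoc (sgn c) s
sgn (ins x s c) = snoc (sgn c) s

-- fx s is a fixed point of sign s; nd a b is a node that is larger than its predecessor iff a, and smaller
-- than its successor iff b, in the cyclic order of its cycle.
data Kind : Set where
  fx : Bool → Kind
  nd : (in′ out′ : Bool) → Kind

into out : Kind → Bool
into (fx _)   = false
into (nd a _) = a
out (fx _)   = false
out (nd _ b) = b

leaveTo enterFrom : Bool → Kind → Kind
leaveTo s (fx _)     = nd s (not s)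
leaveTo s (nd a _)   = nd a (not s)
enterFrom s (fx _)   = nd s (not s)
enterFrom s (nd _ b) = nd s b

-- The gap after x is an ascent iff out (kind c x). If the new letter makes the gap after x go the same way,
-- only the successor of x changes its kind, otherwise only x itself does.
kind : Code n → Fin n → Kind
updated : (c : Code n) (x : Fin n) (s : Bool) → Dec (out (kind c x) ≡ s) → Fin n → Kind

kind (fix s c)   = snoc (kind c) (fx s)
kind (ins x s c) = snoc (updated c x s (out (kind c x) Bool.≟ s)) (nd (not s) s)

updated c x s (yes _) = updateAt (kind c) x (leaveTo s)
updated c x s (no _)  = updateAt (kind c) (perm c x) (enterFrom s)

node : Code n → Fin n → ℤ
node c y = val (sgn c y , y)

data Position (x : Fin n) : Fin (suc n) → Set where
  top : Position x (fromℕ n)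
  at  : Position x (inject₁ x)
  off : ∀ h → h ≢ x → Position x (inject₁ h)

position : (x : Fin n) (h : Fin (suc n)) → Position x h
position x h with view h
... | ‵fromℕ = top
... | ‵inject₁ i with i ≟ x
...   | yes refl = at
...   | no i≢x   = off i i≢x

module _ (x : Fin n) (s : Bool) (c : Code n) where

  ent-at : ent (ins x s c) (inject₁ x) ≡ (s , fromℕ n)
  ent-at = trans (snoc-inject₁ _ (raise (ent c x)) x) (updateAt-updates x (raise ∘ ent c))

  ent-off : ∀ {h} → h ≢ x → ent (ins x s c) (inject₁ h) ≡ raise (ent c h)
  ent-off {h} h≢x = trans (snoc-inject₁ _ (raise (ent c x)) h) (updateAt-minimal h x (raise ∘ ent c) h≢x)

  ent-top : ent (ins x s c) (fromℕ n) ≡ raise (ent c x)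
  ent-top = snoc-fromℕ (updateAt (raise ∘ ent c) x (const (s , fromℕ n))) (raise (ent c x))

module _ (s : Bool) (c : Code n) where

  ent-fix-old : ∀ h → ent (fix s c) (inject₁ h) ≡ raise (ent c h)
  ent-fix-old h = snoc-inject₁ (raise ∘ ent c) (s , fromℕ n) h

  ent-fix-top : ent (fix s c) (fromℕ n) ≡ (s , fromℕ n)
  ent-fix-top = snoc-fromℕ (raise ∘ ent c) (s , fromℕ n)

perm-injective : (c : Code n) → Injective _≡_ _≡_ (perm c)
perm-injective {suc n} (fix s c) {h} {h′} eq with view h | view h′
... | ‵fromℕ     | ‵fromℕ = refl
... | ‵fromℕ     | ‵inject₁ i rewrite ent-fix-top s c | ent-fix-old s c i = contradiction eq fromℕ≢inject₁
... | ‵inject₁ i | ‵fromℕ rewrite ent-fix-top s c | ent-fix-old s c i = contradiction (sym eq) fromℕ≢inject₁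
... | ‵inject₁ i | ‵inject₁ j rewrite ent-fix-old s c i | ent-fix-old s c j =
  cong inject₁ (perm-injective c (inject₁-injective eq))
perm-injective {suc n} (ins x s c) {h} {h′} eq with position x h | position x h′
... | top | top = refl
... | top | at rewrite ent-top x s c | ent-at x s c = contradiction (sym eq) fromℕ≢inject₁
... | top | off i i≢x rewrite ent-top x s c | ent-off x s c i≢x =
  contradiction (perm-injective c (inject₁-injective (sym eq))) i≢x
... | at | top rewrite ent-top x s c | ent-at x s c = contradiction eq fromℕ≢inject₁
... | at | at = refl
... | at | off i i≢x rewrite ent-at x s c | ent-off x s c i≢x = contradiction eq fromℕ≢inject₁
... | off i i≢x | top rewrite ent-top x s c | ent-off x s c i≢x =
  contradiction (perm-injective c (inject₁-injective eq)) i≢x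
... | off i i≢x | at rewrite ent-at x s c | ent-off x s c i≢x = contradiction (sym eq) fromℕ≢inject₁
... | off i i≢x | off j j≢x rewrite ent-off x s c i≢x | ent-off x s c j≢x =
  cong inject₁ (perm-injective c (inject₁-injective eq))

sgn-old : ∀ (c : Code n) s (y : Fin n) → snoc (sgn c) s (inject₁ y) ≡ sgn c y
sgn-old c s = snoc-inject₁ (sgn c) s

ent-sgn : (c : Code n) (h : Fin n) → proj₁ (ent c h) ≡ sgn c (perm c h)
ent-sgn {suc n} (fix s c) h with view h
... | ‵fromℕ rewrite ent-fix-top s c = sym (snoc-fromℕ (sgn c) s)
... | ‵inject₁ i rewrite ent-fix-old s c i = trans (ent-sgn c i) (sym (sgn-old c s _))
ent-sgn {suc n} (ins x s c) h with position x h
... | top rewrite ent-top x s c = trans (ent-sgn c x) (sym (sgn-old c s _))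
... | at rewrite ent-at x s c = sym (snoc-fromℕ (sgn c) s)
... | off i i≢x rewrite ent-off x s c i≢x = trans (ent-sgn c i) (sym (sgn-old c s _))

-- At a fixed point both ends of the gap are the same node, and one update has to set both bits.
-- Case analysis on kinds must therefore agree with the actual shape of the cycle.
data Matches (c : Code n) (h : Fin n) : Set where
  fixed : perm c h ≡ h → kind c h ≡ fx (sgn c h) → Matches c h
  moved : perm c h ≢ h → ∀ a b → kind c h ≡ nd a b → Matches c h

-- The gap from `h` to its successor is recorded at both of its ends. Consistency of the two bits is
-- proved together with `matches` along the code; the module below uses both only for the code
-- before the insertion.
into-out : (c : Code n) (h : Fin n) → into (kind c (perm c h)) ≡ out (kind c h)
matches : (c : Code n) (h : Fin n) → Matches c h

module _ (x : Fin n) (s : Bool) (c : Code n) where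
  private
    κ = updated c x s (out (kind c x) Bool.≟ s)

  out-at : out (κ x) ≡ not s
  out-at with out (kind c x) Bool.≟ s
  ... | yes _ rewrite updateAt-updates x {leaveTo s} (kind c) with kind c x
  ...   | fx _   = refl
  ...   | nd _ _ = refl
  out-at | no p with matches c x
  ... | fixed px k with perm c x
  ...   | _ rewrite px | updateAt-updates x {enterFrom s} (kind c) | k = refl
  out-at | no p | moved px a b k
    rewrite updateAt-minimal x (perm c x) {enterFrom s} (kind c) (px ∘ sym) = Bool.¬-not p

  out-off : ∀ {h} → h ≢ x → out (κ h) ≡ out (kind c h)
  out-off {h} h≢x with out (kind c x) Bool.≟ s
  ... | yes _ rewrite updateAt-minimal h x {leaveTo s} (kind c) h≢x = refl
  ... | no _ with h ≟ perm c x
  ...   | no h≢px rewrite updateAt-minimal h (perm c x) {enterFrom s} (kind c) h≢px = refl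
  ...   | yes refl with matches c (perm c x)
  ...     | fixed ph _ = contradiction (perm-injective c ph) h≢x
  ...     | moved _ a b k rewrite updateAt-updates (perm c x) {enterFrom s} (kind c) | k = refl

  into-at : into (κ (perm c x)) ≡ s
  into-at with out (kind c x) Bool.≟ s
  ... | no _ rewrite updateAt-updates (perm c x) {enterFrom s} (kind c) with kind c (perm c x)
  ...   | fx _   = refl
  ...   | nd _ _ = refl
  into-at | yes p with matches c x
  ... | fixed px k rewrite px | updateAt-updates x {leaveTo s} (kind c) | k = refl
  ... | moved px a b k rewrite updateAt-minimal (perm c x) x {leaveTo s} (kind c) px =
    trans (into-out c x) p

  into-off : ∀ {h} → h ≢ x → into (κ (perm c h)) ≡ into (kind c (perm c h))
  into-off {h} h≢x with out (kind c x) Bool.≟ s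
  ... | no _ rewrite updateAt-minimal (perm c h) (perm c x) {enterFrom s} (kind c)
                       (h≢x ∘ perm-injective c) = refl
  ... | yes _ with perm c h ≟ x
  ...   | no ph≢x rewrite updateAt-minimal (perm c h) x {leaveTo s} (kind c) ph≢x = refl
  ...   | yes ph with matches c x
  ...     | fixed px _ = contradiction (perm-injective c (trans ph (sym px))) h≢x
  ...     | moved _ a b k rewrite ph | updateAt-updates x {leaveTo s} (kind c) | k = refl

  moved-at : ∃₂ λ a b → κ x ≡ nd a b
  moved-at with out (kind c x) Bool.≟ s
  ... | yes _ rewrite updateAt-updates x {leaveTo s} (kind c) with kind c x
  ...   | fx _   = _ , _ , refl
  ...   | nd _ _ = _ , _ , refl
  moved-at | no _ with matches c x
  ... | fixed px k rewrite px | updateAt-updates x {enterFrom s} (kind c) | k = _ , _ , refl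
  ... | moved px a b k
    rewrite updateAt-minimal x (perm c x) {enterFrom s} (kind c) (px ∘ sym) = a , b , k

  moved-off : ∀ {h a b} → kind c h ≡ nd a b → ∃₂ λ a b → κ h ≡ nd a b
  moved-off {h} k with out (kind c x) Bool.≟ s
  ... | yes _ with h ≟ x
  ...   | yes refl rewrite updateAt-updates x {leaveTo s} (kind c) | k = _ , _ , refl
  ...   | no h≢x rewrite updateAt-minimal h x {leaveTo s} (kind c) h≢x = _ , _ , k
  moved-off {h} k | no _ with h ≟ perm c x
  ...   | yes refl rewrite updateAt-updates (perm c x) {enterFrom s} (kind c) | k = _ , _ , refl
  ...   | no h≢px rewrite updateAt-minimal h (perm c x) {enterFrom s} (kind c) h≢px = _ , _ , k

  fixed-off : ∀ {h} → h ≢ x → perm c h ≡ h → κ h ≡ kind c h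
  fixed-off {h} h≢x ph with out (kind c x) Bool.≟ s
  ... | yes _ = updateAt-minimal h x (kind c) h≢x
  ... | no _  = updateAt-minimal h (perm c x) (kind c)
                  (λ eq → h≢x (perm-injective c (trans ph eq)))

  kind-old : ∀ h → kind (ins x s c) (inject₁ h) ≡ κ h
  kind-old = snoc-inject₁ κ (nd (not s) s)

  kind-top : kind (ins x s c) (fromℕ n) ≡ nd (not s) s
  kind-top = snoc-fromℕ κ (nd (not s) s)

kind-fix-old : ∀ s (c : Code n) h → kind (fix s c) (inject₁ h) ≡ kind c h
kind-fix-old s c = snoc-inject₁ (kind c) (fx s)

kind-fix-top : ∀ s (c : Code n) → kind (fix s c) (fromℕ n) ≡ fx s
kind-fix-top s c = snoc-fromℕ (kind c) (fx s)

into-out {suc n} (fix s c) h with view h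
... | ‵fromℕ rewrite ent-fix-top s c | kind-fix-top s c = refl
... | ‵inject₁ i rewrite ent-fix-old s c i | kind-fix-old s c i | kind-fix-old s c (perm c i) = into-out c i
into-out {suc n} (ins x s c) h with position x h
... | top rewrite ent-top x s c | kind-old x s c (perm c x) | kind-top x s c = into-at x s c
... | at rewrite ent-at x s c | kind-top x s c | kind-old x s c x = sym (out-at x s c)
... | off i i≢x rewrite ent-off x s c i≢x | kind-old x s c (perm c i) | kind-old x s c i =
  trans (into-off x s c i≢x) (trans (into-out c i) (sym (out-off x s c i≢x)))

matches {suc n} (fix s c) h with view h
... | ‵fromℕ = fixed (cong proj₂ (ent-fix-top s c))
                 (trans (kind-fix-top s c) (cong fx (sym (snoc-fromℕ (sgn c) s))))
... | ‵inject₁ i with matches c i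
...   | fixed p k = fixed (trans (cong proj₂ (ent-fix-old s c i)) (cong inject₁ p))
                      (trans (kind-fix-old s c i) (trans k (cong fx (sym (sgn-old c s i)))))
...   | moved p a b k = moved (λ eq → p (inject₁-injective (trans (sym (cong proj₂ (ent-fix-old s c i))) eq)))
                          a b (trans (kind-fix-old s c i) k)
matches {suc n} (ins x s c) h with position x h
... | top = moved (λ eq → fromℕ≢inject₁ (trans (sym eq) (cong proj₂ (ent-top x s c)))) _ _ (kind-top x s c)
... | at = moved (λ eq → fromℕ≢inject₁ (trans (sym (cong proj₂ (ent-at x s c))) eq)) _ _
             (trans (kind-old x s c x) (proj₂ (proj₂ (moved-at x s c))))
... | off i i≢x with matches c i
...   | fixed p k = fixed (trans (cong proj₂ (ent-off x s c i≢x)) (cong inject₁ p))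
                      (trans (kind-old x s c i) (trans (fixed-off x s c i≢x p)
                        (trans k (cong fx (sym (sgn-old c s i))))))
...   | moved p a b k = moved (λ eq → p (inject₁-injective (trans (sym (cong proj₂ (ent-off x s c i≢x))) eq)))
                          _ _ (trans (kind-old x s c i) (proj₂ (proj₂ (moved-off x s c k))))

-- Kinds and the order of the integers

val-inject₁ : ∀ s (y : Fin n) → val (s , inject₁ y) ≡ val (s , y)
val-inject₁ false y = cong (+_ ∘ suc) (toℕ-inject₁ y)
val-inject₁ true  y = cong -[1+_] (toℕ-inject₁ y)

⌊⌋-true : {P : Set} (P? : Dec P) → P → ⌊ P? ⌋ ≡ true
⌊⌋-true (yes _) p = refl
⌊⌋-true (no ¬p) p = contradiction p ¬p

⌊⌋-false : {P : Set} (P? : Dec P) → ¬ P → ⌊ P? ⌋ ≡ false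
⌊⌋-false (yes p) ¬p = contradiction p ¬p
⌊⌋-false (no _)  ¬p = refl

⌊⌋-true⁻ : {P : Set} (P? : Dec P) → ⌊ P? ⌋ ≡ true → P
⌊⌋-true⁻ (yes p) eq = p

-- The inserted letter has the largest absolute value, so its sign alone decides the comparison.
old<?top : ∀ (e : SEntry n) s → ⌊ val e ℤ.<? val (s , fromℕ n) ⌋ ≡ not s
old<?top {n} (false , y) false rewrite toℕ-fromℕ n = ⌊⌋-true (_ ℤ.<? _) (ℤ.+<+ (ℕ.s<s (toℕ<n y)))
old<?top     (true  , y) false = refl
old<?top     (false , y) true  = refl
old<?top {n} (true  , y) true rewrite toℕ-fromℕ n = ⌊⌋-false (_ ℤ.<? _) λ { (ℤ.-<- p) → ℕ.<-asym p (toℕ<n y) }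

top<?old : ∀ (e : SEntry n) s → ⌊ val (s , fromℕ n) ℤ.<? val e ⌋ ≡ s
top<?old     (false , y) true = refl
top<?old {n} (true  , y) true rewrite toℕ-fromℕ n = ⌊⌋-true (_ ℤ.<? _) (ℤ.-<- (toℕ<n y))
top<?old {n} (false , y) false rewrite toℕ-fromℕ n = ⌊⌋-false (_ ℤ.<? _) λ { (ℤ.+<+ (ℕ.s<s p)) → ℕ.<-asym p (toℕ<n y) }
top<?old     (true  , y) false = refl

module _ (c : Code n) (s : Bool) where

  snoc-node-old : ∀ y → val (snoc (sgn c) s (inject₁ y) , inject₁ y) ≡ node c y
  snoc-node-old y = trans (val-inject₁ _ y) (cong (λ t → val (t , y)) (sgn-old c s y))

  snoc-node-top : val (snoc (sgn c) s (fromℕ n) , fromℕ n) ≡ val (s , fromℕ n)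
  snoc-node-top = cong (λ t → val (t , fromℕ n)) (snoc-fromℕ (sgn c) s)

-- The bits of a kind are maintained without looking at values; here they meet the integers. Pairs
-- of old letters keep their comparison, a pair with the new letter is decided by its sign, and a
-- fixed point is no ascent because the order is strict.
out-ascent : (c : Code n) (h : Fin n) → out (kind c h) ≡ ⌊ node c h ℤ.<? node c (perm c h) ⌋
out-ascent {suc n} (fix s c) h with view h
... | ‵fromℕ rewrite ent-fix-top s c | kind-fix-top s c = sym (⌊⌋-false (_ ℤ.<? _) (ℤ.<-irrefl refl))
... | ‵inject₁ i rewrite ent-fix-old s c i | kind-fix-old s c i
                       | snoc-node-old c s i | snoc-node-old c s (perm c i) = out-ascent c i
out-ascent {suc n} (ins x s c) h with position x h
... | top rewrite ent-top x s c | kind-top x s c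
                | snoc-node-top c s | snoc-node-old c s (perm c x) = sym (top<?old (sgn c (perm c x) , perm c x) s)
... | at rewrite ent-at x s c | kind-old x s c x
               | snoc-node-top c s | snoc-node-old c s x =
  trans (out-at x s c) (sym (old<?top (sgn c x , x) s))
... | off i i≢x rewrite ent-off x s c i≢x | kind-old x s c i
                      | snoc-node-old c s i | snoc-node-old c s (perm c i) =
  trans (out-off x s c i≢x) (out-ascent c i)

-- Every signed permutation has exactly one code

raise-injective : {a b : SEntry n} → raise a ≡ raise b → a ≡ b
raise-injective eq = cong₂ _,_ (cong proj₁ eq) (inject₁-injective (cong proj₂ eq))

lowered : (e : SEntry (suc n)) → proj₂ e ≢ fromℕ n → ∃ λ e₀ → raise e₀ ≡ e
lowered (s , y) y≢top with view y
... | ‵fromℕ     = contradiction refl y≢top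
... | ‵inject₁ i = (s , i) , refl

-- Otherwise `f` would factor through `inject₁` and embed `Fin (suc n)` into `Fin n`.
top-attained : (f : Fin (suc n) → Fin (suc n)) → Injective _≡_ _≡_ f → ∃ λ x → f x ≡ fromℕ n
top-attained {n} f inj with any? (λ x → f x ≟ fromℕ n)
... | yes p = p
... | no ¬p = ⊥-elim (<⇒notInjective {f = proj₂ ∘ proj₁ ∘ low} (ℕ.n<1+n n) low-injective)
  where
  low : ∀ x → ∃ λ e₀ → raise e₀ ≡ (true , f x)
  -- The sign is a dummy: `lowered` serves here for the index alone.
  low x = lowered (true , f x) (λ eq → ¬p (x , eq))

  low-injective : Injective _≡_ _≡_ (proj₂ ∘ proj₁ ∘ low)
  low-injective {x} {y} eq = inj (trans (sym (cong proj₂ (proj₂ (low x))))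
    (trans (cong inject₁ eq) (cong proj₂ (proj₂ (low y)))))

-- Deleting the largest letter undoes the last step: if it is its own successor it was adjoined as a
-- fixed point, and otherwise its predecessor `x` takes over its entry, which bypasses it in the
-- cycle.
encode : (e : Fin n → SEntry n) → Injective _≡_ _≡_ (proj₂ ∘ e) → ∃ λ c → ∀ h → ent c h ≡ e h
encode {zero} e inj = nil , λ ()
encode {suc n} e inj with proj₂ (e (fromℕ n)) ≟ fromℕ n
... | yes eq = fix s c₀ , agrees
  where
  s = proj₁ (e (fromℕ n))

  e₀ : ∀ i → ∃ λ a → raise a ≡ e (inject₁ i)
  e₀ i = lowered _ (λ p → fromℕ≢inject₁ (inj (trans eq (sym p))))

  e₀-injective : Injective _≡_ _≡_ (proj₂ ∘ proj₁ ∘ e₀)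
  e₀-injective {i} {j} p = inject₁-injective (inj (trans (sym (cong proj₂ (proj₂ (e₀ i))))
    (trans (cong inject₁ p) (cong proj₂ (proj₂ (e₀ j))))))

  code = encode (proj₁ ∘ e₀) e₀-injective
  c₀   = proj₁ code

  agrees : ∀ h → ent (fix s c₀) h ≡ e h
  agrees h with view h
  ... | ‵fromℕ     = trans (ent-fix-top s c₀) (cong (s ,_) (sym eq))
  ... | ‵inject₁ i = trans (ent-fix-old s c₀ i) (trans (cong raise (proj₂ code i)) (proj₂ (e₀ i)))
... | no ¬eq with top-attained (proj₂ ∘ e) inj
...   | x , px with view x
...     | ‵fromℕ     = contradiction px ¬eq
...     | ‵inject₁ x = ins x s c₀ , agrees
  where
  s = proj₁ (e (inject₁ x))

  -- The outcome of the test `i ≟ x` is kept in the type, so that injectivity and agreement can be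
  -- argued from what `e₀` satisfies instead of from how it is computed.
  Shortcut : Fin n → SEntry n → Set
  Shortcut i a = (i ≡ x × raise a ≡ e (fromℕ n)) ⊎ (i ≢ x × raise a ≡ e (inject₁ i))

  e₀ : ∀ i → ∃ (Shortcut i)
  e₀ i with i ≟ x
  ... | yes refl = let a , p = lowered (e (fromℕ n)) ¬eq in a , inj₁ (refl , p)
  ... | no i≢x   = let a , p = lowered (e (inject₁ i)) (λ q → i≢x (inject₁-injective (inj (trans q (sym px)))))
                   in a , inj₂ (i≢x , p)

  e₀-injective : Injective _≡_ _≡_ (proj₂ ∘ proj₁ ∘ e₀)
  e₀-injective {i} {j} eq with e₀ i | e₀ j
  ... | a , inj₁ (refl , _) | b , inj₁ (refl , _) = refl
  ... | a , inj₂ (_ , p) | b , inj₂ (_ , q) =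
    inject₁-injective (inj (trans (sym (cong proj₂ p)) (trans (cong inject₁ eq) (cong proj₂ q))))
  ... | a , inj₁ (_ , p) | b , inj₂ (_ , q) =
    contradiction (inj (trans (sym (cong proj₂ p)) (trans (cong inject₁ eq) (cong proj₂ q)))) fromℕ≢inject₁
  ... | a , inj₂ (_ , p) | b , inj₁ (_ , q) =
    contradiction (inj (sym (trans (sym (cong proj₂ p)) (trans (cong inject₁ eq) (cong proj₂ q))))) fromℕ≢inject₁

  code = encode (proj₁ ∘ e₀) e₀-injective
  c₀   = proj₁ code

  shortcut : ∀ i → Shortcut i (ent c₀ i)
  shortcut i = subst (Shortcut i) (sym (proj₂ code i)) (proj₂ (e₀ i))

  agrees : ∀ h → ent (ins x s c₀) h ≡ e h
  agrees h with position x h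
  ... | at = trans (ent-at x s c₀) (cong (s ,_) (sym px))
  ... | top with shortcut x
  ...   | inj₁ (_ , p)   = trans (ent-top x s c₀) p
  ...   | inj₂ (x≢x , _) = contradiction refl x≢x
  agrees h | off i i≢x with shortcut i
  ...   | inj₁ (i≡x , _) = contradiction i≡x i≢x
  ...   | inj₂ (_ , p)   = trans (ent-off x s c₀ i≢x) p

-- The position that holds the largest letter reveals the last step: it is `fromℕ n` after `fix` and
-- `inject₁ x` after `ins x`, and its entry shows the sign.
ent-injective : (c d : Code n) → (∀ h → ent c h ≡ ent d h) → c ≡ d
ent-injective nil nil eq = refl
ent-injective {suc n} (fix s c) (fix t d) eq = cong₂ fix
  (cong proj₁ (trans (sym (ent-fix-top s c)) (trans (eq (fromℕ n)) (ent-fix-top t d))))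
  (ent-injective c d λ h → raise-injective
    (trans (sym (ent-fix-old s c h)) (trans (eq (inject₁ h)) (ent-fix-old t d h))))
ent-injective {suc n} (fix s c) (ins y t d) eq = contradiction
  (cong proj₂ (trans (sym (ent-fix-top s c)) (trans (eq (fromℕ n)) (ent-top y t d)))) fromℕ≢inject₁
ent-injective {suc n} (ins x s c) (fix t d) eq = contradiction
  (cong proj₂ (trans (sym (ent-fix-top t d)) (trans (sym (eq (fromℕ n))) (ent-top x s c)))) fromℕ≢inject₁
ent-injective {suc n} (ins x s c) (ins y t d) eq with x ≟ y
... | no x≢y = contradiction
  (cong proj₂ (trans (sym (ent-at x s c)) (trans (eq (inject₁ x)) (ent-off y t d x≢y)))) fromℕ≢inject₁
... | yes refl = cong₂ (ins x)
  (cong proj₁ (trans (sym (ent-at x s c)) (trans (eq (inject₁ x)) (ent-at x t d))))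
  (ent-injective c d agrees)
  where
  agrees : ∀ h → ent c h ≡ ent d h
  agrees h with h ≟ x
  ... | yes refl = raise-injective (trans (sym (ent-top x s c)) (trans (eq (fromℕ n)) (ent-top x t d)))
  ... | no h≢x   = raise-injective
    (trans (sym (ent-off x s c h≢x)) (trans (eq (inject₁ h)) (ent-off x t d h≢x)))

-- Cycle double ascents, locally

iter-suc : ∀ (f : Fin n → Fin n) k x → iter f k (f x) ≡ iter f (suc k) x
iter-suc f zero    x = refl
iter-suc f (suc k) x = cong f (iter-suc f k x)

iter-+ : ∀ (f : Fin n → Fin n) j k x → iter f (j + k) x ≡ iter f j (iter f k x)
iter-+ f zero    k x = refl
iter-+ f (suc j) k x = cong f (iter-+ f j k x)

iter-injective : ∀ (f : Fin n → Fin n) → Injective _≡_ _≡_ f → ∀ k → Injective _≡_ _≡_ (iter f k)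
iter-injective f inj zero    eq = eq
iter-injective f inj (suc k) eq = iter-injective f inj k (inj eq)

-- Two of the iterates 0, ..., n agree by the pigeonhole principle, and cancelling the shorter
-- iteration leaves a return after at most `n` steps. The bound is what makes the fuel `n` in
-- `cycLen` sufficient.
returns : ∀ (f : Fin n → Fin n) → Injective _≡_ _≡_ f → ∀ a → ∃ λ r → suc r ℕ.≤ n × iter f (suc r) a ≡ a
returns {n} f inj a with pigeonhole (ℕ.n<1+n n) (λ k → iter f (toℕ k) a)
... | i , j , i<j , eq with ℕ.m≤n⇒∃[o]m+o≡n i<j
...   | r , si+r = r , bound , iter-injective f inj (toℕ i) (sym (trans eq (trans (cong (λ k → iter f k a) j≡) (iter-+ f (toℕ i) (suc r) a))))
  where
  j≡ : toℕ j ≡ toℕ i + suc r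
  j≡ = trans (sym si+r) (sym (ℕ.+-suc (toℕ i) r))

  bound : suc r ℕ.≤ n
  bound = ℕ.≤-trans (ℕ.m≤n+m (suc r) (toℕ i)) (ℕ.≤-trans (ℕ.≤-reflexive (sym j≡)) (ℕ.≤-pred (toℕ<n j)))

stepsTo-returns : ∀ (f : Fin n → Fin n) fuel a x r → suc r ℕ.≤ fuel → iter f (suc r) x ≡ a →
                  ∃ λ L → stepsTo f fuel a x ≡ suc L × iter f (suc L) x ≡ a
stepsTo-returns f (suc fuel) a x r r≤ eq with f x ≟ a
... | yes fx≡a = 0 , refl , fx≡a
stepsTo-returns f (suc fuel) a x zero    r≤ eq | no fx≢a = contradiction eq fx≢a
stepsTo-returns f (suc fuel) a x (suc r) (ℕ.s≤s r≤) eq | no fx≢a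
  with stepsTo-returns f fuel a (f x) r r≤ (trans (iter-suc f (suc r) x) eq)
... | L , p , q = suc L , cong suc p , trans (sym (iter-suc f (suc L) x)) q

module Walk (f : Fin n → Fin n) (e : Fin n → ℤ) where

  walk : ℕ → Fin n → List ℤ
  walk zero    a = []
  walk (suc k) a = e a ∷ walk k (f a)

  applyUpTo-walk : ∀ g k a → (∀ i → g i ≡ e (iter f i a)) → applyUpTo g k ≡ walk k a
  applyUpTo-walk g zero    a eq = refl
  applyUpTo-walk g (suc k) a eq = cong₂ _∷_ (eq 0)
    (applyUpTo-walk (g ∘ suc) k (f a) (λ i → trans (eq (suc i)) (cong e (sym (iter-suc f i a)))))

  map-upTo-walk : ∀ k a → map (λ i → e (iter f i a)) (upTo k) ≡ walk k a
  map-upTo-walk k a = trans (List.map-applyUpTo (λ i → i) (λ i → e (iter f i a)) k)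
    (applyUpTo-walk _ k a (λ _ → refl))

  walk-++ : ∀ p q a → walk (p + q) a ≡ walk p a ++ walk q (iter f p a)
  walk-++ zero    q a = refl
  walk-++ (suc p) q a = cong (e a ∷_) (trans (walk-++ p q (f a)) (cong (λ x → walk p (f a) ++ walk q x) (iter-suc f p a)))

  drop-walk : ∀ p q a → drop p (walk (p + q) a) ≡ walk q (iter f p a)
  drop-walk zero    q a = refl
  drop-walk (suc p) q a = trans (drop-walk p q (f a)) (cong (walk q) (iter-suc f p a))

  take-walk : ∀ p q a → take p (walk (p + q) a) ≡ walk p a
  take-walk zero    q a = refl
  take-walk (suc p) q a = cong (e a ∷_) (take-walk p q (f a))

  ∈-walk : ∀ {t k} a → t ℕ.< k → e (iter f t a) ∈ walk k a
  ∈-walk {zero}  {suc k} a t<k = here refl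
  ∈-walk {suc t} {suc k} a (ℕ.s≤s t<k) = there (subst (λ x → e x ∈ walk k (f a)) (iter-suc f t a) (∈-walk (f a) t<k))

  first-hit : ∀ M k a → M ∈ walk k a →
    let r = length (takeWhileᵇ (λ x → not ⌊ x ℤ.≟ M ⌋) (walk k a))
    in (∃ λ q → k ≡ suc r + q) × e (iter f r a) ≡ M
  first-hit M (suc k) a M∈ with e a ℤ.≟ M
  ... | yes p = (k , refl) , p
  first-hit M (suc k) a (here M≡)  | no ¬p = contradiction (sym M≡) ¬p
  first-hit M (suc k) a (there M∈) | no ¬p with first-hit M k (f a) M∈
  ... | (q , k≡) , hit = (q , cong suc k≡) , trans (cong e (sym (iter-suc f (length (takeWhileᵇ (λ x → not ⌊ x ℤ.≟ M ⌋) (walk k (f a)))) a))) hit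

  -- The cyclic form of the condition, independent of where a cycle is cut; cycles of length one or
  -- two satisfy it automatically.
  NoDoubleAscent : Set
  NoDoubleAscent = ∀ a → e a ℤ.< e (f a) → e (f a) ℤ.< e (f (f a)) → ⊥

  cdaCycle-walk : NoDoubleAscent → ∀ k a → cdaCycle (walk k a) ≡ 0
  cdaCycle-walk noDA zero                a = refl
  cdaCycle-walk noDA (suc zero)          a = refl
  cdaCycle-walk noDA (suc (suc zero))    a = refl
  cdaCycle-walk noDA (suc (suc (suc k))) a = cong₂ _+_ no-ascent (cdaCycle-walk noDA (suc (suc k)) (f a))
    where
    no-ascent : (if ⌊ e a ℤ.<? e (f a) ⌋ ∧ ⌊ e (f a) ℤ.<? e (f (f a)) ⌋ then 1 else 0) ≡ 0
    no-ascent with e a ℤ.<? e (f a) | e (f a) ℤ.<? e (f (f a))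
    ... | yes p | yes q = ⊥-elim (noDA a p q)
    ... | yes _ | no _  = refl
    ... | no _  | _     = refl

maxList-≥ : ∀ d {x xs} → x ∈ d ∷ xs → x ℤ.≤ maxList xs d
maxList-≥ d {xs = []}     (here refl)         = ℤ.≤-refl
maxList-≥ d {xs = y ∷ ys} (here refl)         = ℤ.≤-trans (maxList-≥ d {xs = ys} (here refl)) (ℤ.i≤j⊔i y _)
maxList-≥ d {xs = y ∷ ys} (there (here refl)) = ℤ.i≤i⊔j y _
maxList-≥ d {xs = y ∷ ys} (there (there x∈))  = ℤ.≤-trans (maxList-≥ d (there x∈)) (ℤ.i≤j⊔i y _)

maxList-∈ : ∀ x xs → maxList xs x ∈ x ∷ xs
maxList-∈ x xs with foldr-selective ℤ.⊔-sel x xs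
... | inj₁ eq = here eq
... | inj₂ p  = there p

cdaCycle-tail : ∀ x xs → cdaCycle (x ∷ xs) ≡ 0 → cdaCycle xs ≡ 0
cdaCycle-tail x []           eq = refl
cdaCycle-tail x (y ∷ [])     eq = refl
cdaCycle-tail x (y ∷ z ∷ xs) eq = ℕ.m+n≡0⇒n≡0 (if ⌊ x ℤ.<? y ⌋ ∧ ⌊ y ℤ.<? z ⌋ then 1 else 0) eq

cdaCycle-++ : ∀ xs {x y z ys} → x ℤ.< y → y ℤ.< z → cdaCycle (xs ++ x ∷ y ∷ z ∷ ys) ≢ 0
cdaCycle-++ [] {x} {y} {z} x<y y<z eq with x ℤ.<? y | y ℤ.<? z
... | no ¬p | _     = ¬p x<y
... | yes _ | no ¬q = ¬q y<z
cdaCycle-++ [] {x} {y} {z} x<y y<z () | yes _ | yes _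
cdaCycle-++ (p ∷ xs) {ys = ys} x<y y<z eq = cdaCycle-++ xs {ys = ys} x<y y<z (cdaCycle-tail p (xs ++ _ ∷ _ ∷ _ ∷ ys) eq)

∈-sum-0 : ∀ {A : Set} (f : A → ℕ) {xs x} → x ∈ xs → ListAction.sum (map f xs) ≡ 0 → f x ≡ 0
∈-sum-0 f {x ∷ xs} (here refl) eq = ℕ.m+n≡0⇒m≡0 (f x) eq
∈-sum-0 f {x ∷ xs} (there x∈)  eq = ∈-sum-0 f x∈ (ℕ.m+n≡0⇒n≡0 (f x) eq)

sum-0 : ∀ {A : Set} (f : A → ℕ) xs → (∀ {x} → x ∈ xs → f x ≡ 0) → ListAction.sum (map f xs) ≡ 0
sum-0 f []       all0 = refl
sum-0 f (x ∷ xs) all0 = cong₂ _+_ (all0 (here refl)) (sum-0 f xs (all0 ∘ there))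

module Rotation (f : Fin n → Fin n) (e : Fin n → ℤ) where
  open Walk f e

  -- Here `r` is the index of the first maximum and `q` the number of entries after it. Rotation
  -- moves these `q` entries to the front.
  rotateMaxLast-walk : ∀ L a → ∃₂ λ r q → suc L ≡ suc r + q
    × rotateMaxLast (walk (suc L) a) ≡ walk q (iter f (suc r) a) ++ walk (suc r) a
    × (∀ t → t ℕ.< suc r + q → e (iter f t a) ℤ.≤ e (iter f r a))
  rotateMaxLast-walk L a = r , q , L≡ , rotated , bound
    where
    M   = maxList (walk L (f a)) (e a)
    hit = first-hit M (suc L) a (maxList-∈ (e a) (walk L (f a)))
    r   = length (takeWhileᵇ (λ x → not ⌊ x ℤ.≟ M ⌋) (walk (suc L) a))
    q   = proj₁ (proj₁ hit)
    L≡  : suc L ≡ suc r + q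
    L≡  = proj₂ (proj₁ hit)

    rotated : drop (suc r) (walk (suc L) a) ++ take (suc r) (walk (suc L) a)
            ≡ walk q (iter f (suc r) a) ++ walk (suc r) a
    rotated = trans (cong (λ k → drop (suc r) (walk k a) ++ take (suc r) (walk k a)) L≡)
                    (cong₂ _++_ (drop-walk (suc r) q a) (take-walk (suc r) q a))

    bound : ∀ t → t ℕ.< suc r + q → e (iter f t a) ℤ.≤ e (iter f r a)
    bound t t< = ℤ.≤-trans
      (maxList-≥ (e a) (∈-walk a (subst (t ℕ.<_) (sym L≡) t<)))
      (ℤ.≤-reflexive (sym (proj₂ hit)))

module _ (π : SArr n) (inj : Injective _≡_ _≡_ (absMap π)) where
  private
    f = absMap π
    e = πv π
  open Walk f e public
  open Rotation f e

  stdCycle-walk : ∀ a → ∃₂ λ r q → iter f (suc r + q) a ≡ a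
    × stdCycle π a ≡ walk q (iter f (suc r) a) ++ walk (suc r) a
    × (∀ t → t ℕ.< suc r + q → e (iter f t a) ℤ.≤ e (iter f r a))
  stdCycle-walk a =
    let m , m≤n , ret               = returns f inj a
        L , len≡ , retL             = stepsTo-returns f n a a m m≤n ret
        r , q , L≡ , rotated , max = rotateMaxLast-walk L a
        std = trans (cong rotateMaxLast (trans (map-upTo-walk (cycLen π a) a) (cong (λ k → walk k a) len≡))) rotated
    in r , q , subst (λ k → iter f k a ≡ a) L≡ retL , std , max

  stdCycle-∈ : ∀ a → stdCycle π a ∈ stdCycles π
  stdCycle-∈ a = ∈-deduplicate⁺ (List.≡-dec ℤ._≟_) (∈-map⁺ (stdCycle π) (∈-allFin a))

  -- After `q` steps from `b` the walk is back at `a`, so the two pieces of the rotated cycle join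
  -- into a single walk from `b`, and every linear triple in it is a cyclic one.
  cdaCycle-stdCycle : NoDoubleAscent → ∀ a → cdaCycle (stdCycle π a) ≡ 0
  cdaCycle-stdCycle noDA a =
    let r , q , ret , std , _ = stdCycle-walk a
        b    = iter f (suc r) a
        back = trans (sym (iter-+ f q (suc r) a)) (trans (cong (λ k → iter f k a) (ℕ.+-comm q (suc r))) ret)
        once = trans (walk-++ q (suc r) b) (cong (λ x → walk q b ++ walk (suc r) x) back)
    in trans (cong cdaCycle (trans std (sym once))) (cdaCycle-walk noDA (q + suc r) b)

  -- A sum of natural numbers vanishes iff all its terms do, so membership in `stdCycles` is all
  -- that has to be tracked through `deduplicate`.
  noDoubleAscent⇒cda≡0 : NoDoubleAscent → cda π ≡ 0
  noDoubleAscent⇒cda≡0 noDA = sum-0 cdaCycle (stdCycles π) λ xs∈ →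
    let a , _ , eq = ∈-map⁻ (stdCycle π) (∈-deduplicate⁻ (List.≡-dec ℤ._≟_) (map (stdCycle π) (allFin n)) xs∈)
    in trans (cong cdaCycle eq) (cdaCycle-stdCycle noDA a)

  -- The maximum of the cycle is neither e a nor e (f a), so it comes after them in the walk from a:
  -- the cut made by the rotation does not separate the triple.
  triple-uncut : ∀ r q {a} → e a ℤ.< e (f a) → e (f a) ℤ.< e (f (f a)) →
    iter f (suc r + q) a ≡ a → (∀ t → t ℕ.< suc r + q → e (iter f t a) ℤ.≤ e (iter f r a)) →
    ∃ λ ys → walk (suc r) a ≡ e a ∷ e (f a) ∷ e (f (f a)) ∷ ys
  triple-uncut zero          zero    up₁ up₂ ret max = contradiction (sym (cong e ret)) (ℤ.<⇒≢ up₁)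
  triple-uncut zero          (suc q) up₁ up₂ ret max = contradiction (max 1 (ℕ.s≤s (ℕ.s≤s ℕ.z≤n))) (ℤ.<⇒≱ up₁)
  triple-uncut (suc zero)    zero    up₁ up₂ ret max = ⊥-elim (ℤ.<-asym up₁ (subst (λ x → e (f _) ℤ.< e x) ret up₂))
  triple-uncut (suc zero)    (suc q) up₁ up₂ ret max = contradiction (max 2 (ℕ.s≤s (ℕ.s≤s (ℕ.s≤s ℕ.z≤n)))) (ℤ.<⇒≱ up₂)
  triple-uncut (suc (suc r)) q       up₁ up₂ ret max = _ , refl

  -- The standard cycle is computed from the index `a` at which the ascending triple begins, so the
  -- triple heads the second piece of the rotation.
  cda≡0⇒noDoubleAscent : cda π ≡ 0 → NoDoubleAscent
  cda≡0⇒noDoubleAscent eq a up₁ up₂ =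
    let r , q , ret , std , max = stdCycle-walk a
        ys , uncut              = triple-uncut r q up₁ up₂ ret max
        split                   = trans std (cong (walk q (iter f (suc r) a) ++_) uncut)
    in cdaCycle-++ (walk q (iter f (suc r) a)) {ys = ys} up₁ up₂
         (trans (cong cdaCycle (sym split)) (∈-sum-0 cdaCycle (stdCycle-∈ a) eq))

-- Counting by kinds of nodes

⟦_⟧ : Bool → ℕ
⟦ b ⟧ = if b then 1 else 0

pattern posFix = fx false
pattern negFix = fx true
pattern valley = nd false true
pattern peak   = nd true false
pattern desc   = nd false false
pattern asc    = nd true true

_==_ : Kind → Kind → Bool
posFix == posFix = true
negFix == negFix = true
valley == valley = true
peak   == peak   = true
desc   == desc   = true
asc    == asc    = true
_      == _      = false

sum-snoc : (G : A → ℕ) (t : Fin n → A) (a : A) → sum (G ∘ snoc t a) ≡ G a + sum (G ∘ t)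
sum-snoc {n = n} G t a = begin
  sum (G ∘ snoc t a)
    ≡⟨ sum-init-last (G ∘ snoc t a) ⟩
  sum (G ∘ snoc t a ∘ inject₁) + G (snoc t a (fromℕ n))
    ≡⟨ cong₂ _+_ (sum-cong-≗ (cong G ∘ snoc-inject₁ t a)) (cong G (snoc-fromℕ t a)) ⟩
  sum (G ∘ t) + G a
    ≡⟨ ℕ.+-comm (sum (G ∘ t)) (G a) ⟩
  G a + sum (G ∘ t) ∎
  where open ≡-Reasoning

sum-updateAt : (G : A → ℕ) (t : Fin n → A) (z : Fin n) (m : A → A) →
               sum (G ∘ updateAt t z m) + G (t z) ≡ G (m (t z)) + sum (G ∘ t)
sum-updateAt {n = suc n} G t zero m = trans (ℕ.+-assoc (G (m (t zero))) (sum (G ∘ t ∘ suc)) (G (t zero)))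
  (cong (G (m (t zero)) ℕ.+_) (ℕ.+-comm (sum (G ∘ t ∘ suc)) (G (t zero))))
sum-updateAt {n = suc n} G t (suc z) m = begin
  (g₀ + sum (G ∘ updateAt (t ∘ suc) z m)) + G (t (suc z))  ≡⟨ ℕ.+-assoc g₀ _ _ ⟩
  g₀ + (sum (G ∘ updateAt (t ∘ suc) z m) + G (t (suc z)))  ≡⟨ cong (g₀ ℕ.+_) (sum-updateAt G (t ∘ suc) z m) ⟩
  g₀ + (a + sum (G ∘ t ∘ suc))                             ≡⟨ swap g₀ a _ ⟩
  a + (g₀ + sum (G ∘ t ∘ suc))                             ∎
  where
  open ≡-Reasoning
  g₀ = G (t zero)
  a  = G (m (t (suc z)))
  swap : ∀ x y w → x + (y + w) ≡ y + (x + w)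
  swap = solve-∀

term≤sum : (t : Fin n → ℕ) (z : Fin n) → t z ℕ.≤ sum t
term≤sum {suc n} t zero    = ℕ.m≤m+n _ _
term≤sum {suc n} t (suc z) = ℕ.≤-trans (term≤sum (t ∘ suc) z) (ℕ.m≤n+m _ _)

sum-updateAt-∸ : (G : A → ℕ) (t : Fin n → A) (z : Fin n) (m : A → A) →
                 sum (G ∘ updateAt t z m) ≡ G (m (t z)) + (sum (G ∘ t) ∸ G (t z))
sum-updateAt-∸ G t z m = begin
  sum (G ∘ updateAt t z m)                          ≡⟨ ℕ.m+n∸n≡m _ (G (t z)) ⟨
  (sum (G ∘ updateAt t z m) + G (t z)) ∸ G (t z)    ≡⟨ cong (_∸ G (t z)) (sum-updateAt G t z m) ⟩
  (G (m (t z)) + sum (G ∘ t)) ∸ G (t z)             ≡⟨ ℕ.+-∸-assoc (G (m (t z))) (term≤sum (G ∘ t) z) ⟩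
  G (m (t z)) + (sum (G ∘ t) ∸ G (t z))             ∎
  where open ≡-Reasoning

-- Follows the code: an insertion redirects `x` to the new node and lets the new node point to
-- `perm c x`, so the sum of the values gains just `G (fromℕ n)`.
sum-perm : (c : Code n) (G : Fin n → ℕ) → sum (G ∘ perm c) ≡ sum G
sum-perm nil G = refl
sum-perm {suc n} (fix s c) G = begin
  sum (G ∘ proj₂ ∘ snoc (raise ∘ ent c) (s , fromℕ n))  ≡⟨ sum-snoc (G ∘ proj₂) (raise ∘ ent c) (s , fromℕ n) ⟩
  G (fromℕ n) + sum (G ∘ inject₁ ∘ perm c)              ≡⟨ cong (G (fromℕ n) ℕ.+_) (sum-perm c (G ∘ inject₁)) ⟩
  G (fromℕ n) + sum (G ∘ inject₁)                       ≡⟨ ℕ.+-comm (G (fromℕ n)) (sum (G ∘ inject₁)) ⟩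
  sum (G ∘ inject₁) + G (fromℕ n)                       ≡⟨ sum-init-last G ⟨
  sum G                                                 ∎
  where open ≡-Reasoning
sum-perm {suc n} (ins x s c) G = begin
  sum (G ∘ proj₂ ∘ snoc (updateAt (raise ∘ ent c) x (const (s , fromℕ n))) (raise (ent c x)))
    ≡⟨ sum-snoc (G ∘ proj₂) (updateAt (raise ∘ ent c) x (const (s , fromℕ n))) (raise (ent c x)) ⟩
  G (inject₁ (perm c x)) + sum (G ∘ proj₂ ∘ updateAt (raise ∘ ent c) x (const (s , fromℕ n)))
    ≡⟨ ℕ.+-comm (G (inject₁ (perm c x))) (sum (G ∘ proj₂ ∘ updateAt (raise ∘ ent c) x (const (s , fromℕ n)))) ⟩
  sum (G ∘ proj₂ ∘ updateAt (raise ∘ ent c) x (const (s , fromℕ n))) + G (inject₁ (perm c x))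
    ≡⟨ sum-updateAt (G ∘ proj₂) (raise ∘ ent c) x (const (s , fromℕ n)) ⟩
  G (fromℕ n) + sum (G ∘ inject₁ ∘ perm c)
    ≡⟨ cong (G (fromℕ n) ℕ.+_) (sum-perm c (G ∘ inject₁)) ⟩
  G (fromℕ n) + sum (G ∘ inject₁)
    ≡⟨ ℕ.+-comm (G (fromℕ n)) (sum (G ∘ inject₁)) ⟩
  sum (G ∘ inject₁) + G (fromℕ n)
    ≡⟨ sum-init-last G ⟨
  sum G ∎
  where open ≡-Reasoning

sumKind : (Kind → ℕ) → ℕ
sumKind F = F posFix + (F negFix + (F valley + (F peak + (F desc + F asc))))

sumKind-+ : ∀ F G → sumKind F + sumKind G ≡ sumKind (λ k → F k + G k)
sumKind-+ F G = interchange (F posFix) (F negFix) (F valley) (F peak) (F desc) (F asc)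
                            (G posFix) (G negFix) (G valley) (G peak) (G desc) (G asc)
  where
  interchange : ∀ a b c d e f a′ b′ c′ d′ e′ f′ →
    (a + (b + (c + (d + (e + f))))) + (a′ + (b′ + (c′ + (d′ + (e′ + f′))))) ≡
    (a + a′) + ((b + b′) + ((c + c′) + ((d + d′) + ((e + e′) + (f + f′)))))
  interchange = solve-∀

sumKind-cong : ∀ {F G} → (∀ k → F k ≡ G k) → sumKind F ≡ sumKind G
sumKind-cong eq = cong₂ _+_ (eq posFix) (cong₂ _+_ (eq negFix) (cong₂ _+_ (eq valley)
  (cong₂ _+_ (eq peak) (cong₂ _+_ (eq desc) (eq asc)))))

count : (Fin n → Kind) → Kind → ℕ
count κ k = sum (λ h → ⟦ κ h == k ⟧)

select : ∀ k (G : Kind → ℕ) → G k ≡ sumKind (λ j → ⟦ k == j ⟧ * G j)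
select posFix G = sym (trans (ℕ.+-identityʳ _) (ℕ.+-identityʳ _))
select negFix G = sym (trans (ℕ.+-identityʳ _) (ℕ.+-identityʳ _))
select valley G = sym (trans (ℕ.+-identityʳ _) (ℕ.+-identityʳ _))
select peak   G = sym (trans (ℕ.+-identityʳ _) (ℕ.+-identityʳ _))
select desc   G = sym (trans (ℕ.+-identityʳ _) (ℕ.+-identityʳ _))
select asc    G = sym (ℕ.+-identityʳ _)

sum-by-kind : (κ : Fin n → Kind) (G : Kind → ℕ) → sum (G ∘ κ) ≡ sumKind (λ k → count κ k * G k)
sum-by-kind {zero}  κ G = refl
sum-by-kind {suc n} κ G = begin
  G (κ zero) + sum (G ∘ κ ∘ suc)
    ≡⟨ cong₂ _+_ (select (κ zero) G) (sum-by-kind (κ ∘ suc) G) ⟩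
  sumKind (λ k → ⟦ κ zero == k ⟧ * G k) + sumKind (λ k → count (κ ∘ suc) k * G k)
    ≡⟨ sumKind-+ (λ k → ⟦ κ zero == k ⟧ * G k) (λ k → count (κ ∘ suc) k * G k) ⟩
  sumKind (λ k → ⟦ κ zero == k ⟧ * G k + count (κ ∘ suc) k * G k)
    ≡⟨ sumKind-cong (λ k → ℕ.*-distribʳ-+ (G k) ⟦ κ zero == k ⟧ (count (κ ∘ suc) k)) ⟨
  sumKind (λ k → count κ k * G k) ∎
  where open ≡-Reasoning

#_ : Code n → Kind → ℕ
# c = count (kind c)

ascents : (c : Code n) → sum (λ h → ⟦ into (kind c h) ⟧) ≡ (# c) valley + (# c) asc
ascents c = begin
  sum (λ h → ⟦ into (kind c h) ⟧)             ≡⟨ sum-perm c (⟦_⟧ ∘ into ∘ kind c) ⟨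
  sum (λ h → ⟦ into (kind c (perm c h)) ⟧)    ≡⟨ sum-cong-≗ (cong ⟦_⟧ ∘ into-out c) ⟩
  sum (λ h → ⟦ out (kind c h) ⟧)              ≡⟨ sum-by-kind (kind c) (⟦_⟧ ∘ out) ⟩
  sumKind (λ k → (# c) k * ⟦ out k ⟧)         ≡⟨ tidy ((# c) posFix) ((# c) negFix) ((# c) valley) ((# c) peak) ((# c) desc) ((# c) asc) ⟩
  (# c) valley + (# c) asc                    ∎
  where
  open ≡-Reasoning
  tidy : ∀ p i v k d u → p * 0 + (i * 0 + (v * 1 + (k * 0 + (d * 0 + u * 1)))) ≡ v + u
  tidy = solve-∀

-- Double counting of ascents: their upper ends are the peaks and double ascents, their lower ends
-- the valleys and double ascents.
peaks≡valleys : (c : Code n) → (# c) peak ≡ (# c) valley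
peaks≡valleys c = ℕ.+-cancelʳ-≡ ((# c) asc) _ _ (begin
  (# c) peak + (# c) asc                      ≡⟨ tidy ((# c) posFix) ((# c) negFix) ((# c) valley) ((# c) peak) ((# c) desc) ((# c) asc) ⟨
  sumKind (λ k → (# c) k * ⟦ into k ⟧)        ≡⟨ sum-by-kind (kind c) (⟦_⟧ ∘ into) ⟨
  sum (λ h → ⟦ into (kind c h) ⟧)             ≡⟨ ascents c ⟩
  (# c) valley + (# c) asc                    ∎)
  where
  open ≡-Reasoning
  tidy : ∀ p i v k d u → p * 0 + (i * 0 + (v * 0 + (k * 1 + (d * 0 + u * 1)))) ≡ k + u
  tidy = solve-∀

count-total : (κ : Fin n → Kind) → sumKind (count κ) ≡ n
count-total {n} κ = begin
  sumKind (count κ)                 ≡⟨ sumKind-cong (λ k → ℕ.*-identityʳ (count κ k)) ⟨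
  sumKind (λ k → count κ k * 1)     ≡⟨ sum-by-kind κ (const 1) ⟨
  sum {n} (const 1)                 ≡⟨ ones n ⟩
  n                                 ∎
  where
  open ≡-Reasoning
  ones : ∀ n → sum {n} (const 1) ≡ n
  ones zero    = refl
  ones (suc n) = cong suc (ones n)

-- Weights and their totals over all insertions

-- A function of p, i, v, d, u in this order. The number of peaks is no argument of its own, as it
-- equals v.
Weight : Set
Weight = ℕ → ℕ → ℕ → ℕ → ℕ → ℕ

at# : Weight → (Kind → ℕ) → ℕ
at# W r = W (r posFix) (r negFix) (r valley) (r desc) (r asc)

at#-cong : ∀ W {r r′} → (∀ k → r k ≡ r′ k) → at# W r ≡ at# W r′
at#-cong W eq rewrite eq posFix | eq negFix | eq valley | eq desc | eq asc = refl

module _ (W : Weight) (c : Code n) where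

  -- the weight after ±(n+1) has been inserted and an old node of kind k has become one of kind k′
  turned : Bool → Kind → Kind → ℕ
  turned s k k′ = at# W (λ j → ⟦ nd (not s) s == j ⟧ + (⟦ k′ == j ⟧ + ((# c) j ∸ ⟦ k == j ⟧)))

  -- An insertion after `x` changes either `x` or its successor. Attributing it to the node that
  -- changes splits the weight into a function of the kind of `x` and one of the kind of the
  -- successor, which can be summed separately; 0 stands for a change at the other node.
  leaving entering : Bool → Kind → ℕ
  leaving s k  = if does (out k Bool.≟ s) then turned s k (leaveTo s k) else 0
  entering s k = if does (into k Bool.≟ s) then 0 else turned s k (enterFrom s k)

  at#-ins : ∀ x s → at# W (# ins x s c) ≡ leaving s (kind c x) + entering s (kind c (perm c x))
  -- By `into-out` both tests have the same outcome, so exactly one of the two summands is present.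
  at#-ins x s rewrite into-out c x with out (kind c x) Bool.≟ s
  ... | yes _ = trans
    (at#-cong W λ j → trans (sum-snoc (λ k → ⟦ k == j ⟧) (updateAt (kind c) x (leaveTo s)) (nd (not s) s))
      (cong (⟦ nd (not s) s == j ⟧ ℕ.+_) (sum-updateAt-∸ (λ k → ⟦ k == j ⟧) (kind c) x (leaveTo s))))
    (sym (ℕ.+-identityʳ _))
  ... | no _ =
    (at#-cong W λ j → trans (sum-snoc (λ k → ⟦ k == j ⟧) (updateAt (kind c) (perm c x) (enterFrom s)) (nd (not s) s))
      (cong (⟦ nd (not s) s == j ⟧ ℕ.+_) (sum-updateAt-∸ (λ k → ⟦ k == j ⟧) (kind c) (perm c x) (enterFrom s))))

  sum-ins : ∀ s → sum (λ x → at# W (# ins x s c)) ≡ sumKind (λ k → (# c) k * (leaving s k + entering s k))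
  sum-ins s = begin
    sum (λ x → at# W (# ins x s c))
      ≡⟨ sum-cong-≗ (λ x → at#-ins x s) ⟩
    sum (λ x → leaving s (kind c x) + entering s (kind c (perm c x)))
      ≡⟨ ∑-distrib-+ (leaving s ∘ kind c) (entering s ∘ kind c ∘ perm c) ⟩
    sum (leaving s ∘ kind c) + sum (entering s ∘ kind c ∘ perm c)
      ≡⟨ cong (sum (leaving s ∘ kind c) ℕ.+_) (sum-perm c (entering s ∘ kind c)) ⟩
    sum (leaving s ∘ kind c) + sum (entering s ∘ kind c)
      ≡⟨ ∑-distrib-+ (leaving s ∘ kind c) (entering s ∘ kind c) ⟨
    sum (λ x → leaving s (kind c x) + entering s (kind c x))
      ≡⟨ sum-by-kind (kind c) (λ k → leaving s k + entering s k) ⟩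
    sumKind (λ k → (# c) k * (leaving s k + entering s k)) ∎
    where open ≡-Reasoning

  at#-fix : ∀ s → at# W (# fix s c) ≡ at# W (λ j → ⟦ fx s == j ⟧ + (# c) j)
  at#-fix s = at#-cong W λ j → sum-snoc (λ k → ⟦ k == j ⟧) (kind c) (fx s)

-- The total of a weight over all the ways to adjoin ±(n+1). Every truncated predecessor is harmless,
-- being multiplied by its argument; suc (v ∸ 1) is a valley that disappears while the new letter is one.
grow : Weight → Weight
grow W p i v d u =
  (W (suc p) i v d u + W p (suc i) v d u) +
  (2 * (p * W (p ∸ 1) i (suc v) d u + i * W p (i ∸ 1) (suc v) d u
      + d * W p i (suc v) (d ∸ 1) u + u * W p i (suc v) d (u ∸ 1))
  + (v * (W p i v d (suc u) + W p i v (suc d) u)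
    + v * (W p i (suc (v ∸ 1)) (suc d) u + W p i (suc (v ∸ 1)) d (suc u))))

extend : (Code (suc n) → ℕ) → Code n → ℕ
extend F c = (F (fix false c) + F (fix true c))
  + (sum (λ x → F (ins x false c)) + sum (λ x → F (ins x true c)))

sumCode : (Code n → ℕ) → ℕ
sumCode {zero}  F = F nil
sumCode {suc n} F = sumCode (extend F)

extend-at# : ∀ W (c : Code n) → extend (λ c → at# W (# c)) c ≡ at# (grow W) (# c)
extend-at# W c = begin
  extend (λ c → at# W (# c)) c
    ≡⟨ cong₂ _+_ (cong₂ _+_ (at#-fix W c false) (at#-fix W c true))
                 (cong₂ _+_ (sum-ins W c false) (sum-ins W c true)) ⟩
  _ ≡⟨ cong ((W (suc p) i v d u + W p (suc i) v d u) ℕ.+_)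
         (tidy p i v ((# c) peak) d u (W (p ∸ 1) i (suc v) d u) (W p (i ∸ 1) (suc v) d u)
           (W p i (suc v) (d ∸ 1) u) (W p i (suc v) d (u ∸ 1))
           (W p i v d (suc u) + W p i v (suc d) u)
           (W p i (suc (v ∸ 1)) (suc d) u + W p i (suc (v ∸ 1)) d (suc u))) ⟩
  _ ≡⟨ cong (λ k → (W (suc p) i v d u + W p (suc i) v d u) +
         (2 * (p * W (p ∸ 1) i (suc v) d u + i * W p (i ∸ 1) (suc v) d u
            + d * W p i (suc v) (d ∸ 1) u + u * W p i (suc v) d (u ∸ 1))
          + (k * (W p i v d (suc u) + W p i v (suc d) u)
          + v * (W p i (suc (v ∸ 1)) (suc d) u + W p i (suc (v ∸ 1)) d (suc u))))) (peaks≡valleys c) ⟩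
  at# (grow W) (# c) ∎
  where
  open ≡-Reasoning
  p = (# c) posFix
  i = (# c) negFix
  v = (# c) valley
  d = (# c) desc
  u = (# c) asc
  -- The first row is the positive letter, a new peak, which leaves no old valley changed; the
  -- second is the negative letter, a new valley, which leaves no old peak changed. All other kinds
  -- offer one insertion for each sign.
  tidy : ∀ p i v k d u P I D U X Y →
    (p * (P + 0) + (i * (I + 0) + (v * 0 + (k * X + (d * (D + 0) + u * U)))))
    + (p * P + (i * I + (v * Y + (k * 0 + (d * D + u * (U + 0))))))
    ≡ 2 * (p * P + i * I + d * D + u * U) + (k * X + v * Y)
  tidy = solve-∀

sumCode-cong : {F G : Code n → ℕ} → (∀ c → F c ≡ G c) → sumCode F ≡ sumCode G
sumCode-cong {zero}  eq = eq nil
sumCode-cong {suc n} eq = sumCode-cong λ c →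
  cong₂ _+_ (cong₂ _+_ (eq (fix false c)) (eq (fix true c)))
            (cong₂ _+_ (sum-cong-≗ λ x → eq (ins x false c)) (sum-cong-≗ λ x → eq (ins x true c)))

sumCode-+ : (F G : Code n → ℕ) → sumCode (λ c → F c + G c) ≡ sumCode F + sumCode G
sumCode-+ {zero}  F G = refl
sumCode-+ {suc n} F G = trans (sumCode-cong extend-+) (sumCode-+ (extend F) (extend G))
  where
  tidy : ∀ a b c d x y z w → ((a + b) + (c + d)) + ((x + y) + (z + w)) ≡ ((a + c) + (x + z)) + ((b + d) + (y + w))
  tidy = solve-∀
  extend-+ : ∀ c → extend (λ c → F c + G c) c ≡ extend F c + extend G c
  extend-+ c = trans
    (cong (((F (fix false c) + G (fix false c)) + (F (fix true c) + G (fix true c))) ℕ.+_)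
      (cong₂ _+_ (∑-distrib-+ (λ x → F (ins x false c)) (λ x → G (ins x false c)))
                 (∑-distrib-+ (λ x → F (ins x true c)) (λ x → G (ins x true c)))))
    (tidy (F (fix false c)) (G (fix false c)) (F (fix true c)) (G (fix true c))
          (sum λ x → F (ins x false c)) (sum λ x → G (ins x false c))
          (sum λ x → F (ins x true c)) (sum λ x → G (ins x true c)))

sumCode-* : ∀ k (F : Code n → ℕ) → sumCode (λ c → k * F c) ≡ k * sumCode F
sumCode-* {zero}  k F = refl
sumCode-* {suc n} k F = trans (sumCode-cong extend-*) (sumCode-* k (extend F))
  where
  tidy : ∀ k a b x y → (k * a + k * b) + (k * x + k * y) ≡ k * ((a + b) + (x + y))
  tidy = solve-∀
  extend-* : ∀ c → extend (λ c → k * F c) c ≡ k * extend F c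
  extend-* c = trans
    (cong ((k * F (fix false c) + k * F (fix true c)) ℕ.+_)
      (cong₂ _+_ (sym (*-distribˡ-sum k (λ x → F (ins x false c)))) (sym (*-distribˡ-sum k (λ x → F (ins x true c))))))
    (tidy k (F (fix false c)) (F (fix true c)) (sum λ x → F (ins x false c)) (sum λ x → F (ins x true c)))

sumCode-0 : ∀ n → sumCode {n} (const 0) ≡ 0
sumCode-0 n = sumCode-* {n} 0 (const 0)

-- pre F m is F (m − 1), with value 0 at m = 0.
pre : (ℕ → ℕ) → ℕ → ℕ
pre F zero    = 0
pre F (suc m) = F m

pre-cong : ∀ {F G} → (∀ m → F m ≡ G m) → ∀ m → pre F m ≡ pre G m
pre-cong eq zero    = refl
pre-cong eq (suc m) = eq m

pre-* : ∀ k F m → pre (λ m → k * F m) m ≡ k * pre F m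
pre-* k F zero    = sym (ℕ.*-zeroʳ k)
pre-* k F (suc m) = refl

sumCode-pre : ∀ (F : ℕ → Code n → ℕ) m → sumCode (λ c → pre (λ m → F m c) m) ≡ pre (λ m → sumCode (F m)) m
sumCode-pre {n} F zero = sumCode-0 n
sumCode-pre F (suc m) = refl

-- Point masses and the transposed recurrence

δ : ℕ → ℕ → ℕ
δ a b = ⟦ a ≡ᵇ b ⟧

δ-* : ∀ (f : ℕ → ℕ) a b → f a * δ a b ≡ f b * δ a b
δ-* f zero    zero    = refl
δ-* f zero    (suc b) = trans (ℕ.*-zeroʳ (f 0)) (sym (ℕ.*-zeroʳ (f (suc b))))
δ-* f (suc a) zero    = trans (ℕ.*-zeroʳ (f (suc a))) (sym (ℕ.*-zeroʳ (f 0)))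
δ-* f (suc a) (suc b) = δ-* (f ∘ suc) a b

-- On the support `a` is `suc b`, so a multiplicity of the old permutation becomes a coefficient in
-- the target statistics. At `a = 0`, where truncation falsifies the predecessor, both sides vanish.
δ-pred : ∀ a b → a * δ (a ∸ 1) b ≡ suc b * δ a (suc b)
δ-pred zero    b = sym (ℕ.*-zeroʳ (suc b))
δ-pred (suc a) b = δ-* suc a b

point : ℕ → ℕ → ℕ → ℕ → ℕ → Weight
point p₀ i₀ v₀ d₀ u₀ p i v d u = δ p p₀ * (δ i i₀ * (δ v v₀ * (δ d d₀ * δ u u₀)))

-- The transpose of grow: it acts on the target statistics instead of those of the permutation.
spread : Weight → Weight
spread X p i v d u =
  (pre (λ p → X p i v d u) p + pre (λ i → X p i v d u) i) +
  (2 * pre (λ v → suc p * X (suc p) i v d u + suc i * X p (suc i) v d u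
                + suc d * X p i v (suc d) u + suc u * X p i v d (suc u)) v
  + 2 * (v * (pre (λ d → X p i v d u) d + pre (λ u → X p i v d u) u)))

module _ (p i v d u : ℕ) where

  grow-point : ∀ p₀ i₀ v₀ d₀ u₀ → grow (point p₀ i₀ v₀ d₀ u₀) p i v d u ≡
               spread (λ p₀ i₀ v₀ d₀ u₀ → point p₀ i₀ v₀ d₀ u₀ p i v d u) p₀ i₀ v₀ d₀ u₀
  grow-point p₀ i₀ v₀ d₀ u₀ =
    cong₂ _+_ (cong₂ _+_ (new-posFix p₀) (new-negFix i₀))
              (cong₂ _+_ (cong (2 *_) (new-valley v₀)) new-monotone)
    where
    P = λ p₀ i₀ v₀ d₀ u₀ → point p₀ i₀ v₀ d₀ u₀ p i v d u

    new-posFix : ∀ p₀ → point p₀ i₀ v₀ d₀ u₀ (suc p) i v d u ≡ pre (λ p₀ → P p₀ i₀ v₀ d₀ u₀) p₀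
    new-posFix zero     = refl
    new-posFix (suc p₀) = refl

    new-negFix : ∀ i₀ → point p₀ i₀ v₀ d₀ u₀ p (suc i) v d u ≡ pre (λ i₀ → P p₀ i₀ v₀ d₀ u₀) i₀
    new-negFix zero     = ℕ.*-zeroʳ (δ p p₀)
    new-negFix (suc i₀) = refl

    new-valley : ∀ v₀ →
      p * point p₀ i₀ v₀ d₀ u₀ (p ∸ 1) i (suc v) d u + i * point p₀ i₀ v₀ d₀ u₀ p (i ∸ 1) (suc v) d u
      + d * point p₀ i₀ v₀ d₀ u₀ p i (suc v) (d ∸ 1) u + u * point p₀ i₀ v₀ d₀ u₀ p i (suc v) d (u ∸ 1)
      ≡ pre (λ v₀ → suc p₀ * P (suc p₀) i₀ v₀ d₀ u₀ + suc i₀ * P p₀ (suc i₀) v₀ d₀ u₀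
                  + suc d₀ * P p₀ i₀ v₀ (suc d₀) u₀ + suc u₀ * P p₀ i₀ v₀ d₀ (suc u₀)) v₀
    new-valley zero = zeros p i d u (δ (p ∸ 1) p₀) (δ p p₀) (δ i i₀) (δ (i ∸ 1) i₀)
      where
      zeros : ∀ p i d u a a′ b b′ →
        p * (a * (b * 0)) + i * (a′ * (b′ * 0)) + d * (a′ * (b * 0)) + u * (a′ * (b * 0)) ≡ 0
      zeros = solve-∀
    new-valley (suc v₀) = cong₂ _+_ (cong₂ _+_ (cong₂ _+_
      (move p (suc p₀) (δ-pred p p₀) (λ k a → sym (ℕ.*-assoc k a (δ i i₀ * (δ v v₀ * (δ d d₀ * δ u u₀))))))
      (move i (suc i₀) (δ-pred i i₀) (λ k a → gather₂ k (δ p p₀) a (δ v v₀ * (δ d d₀ * δ u u₀)))))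
      (move d (suc d₀) (δ-pred d d₀) (λ k a → gather₄ k (δ p p₀) (δ i i₀) (δ v v₀) a (δ u u₀))))
      (move u (suc u₀) (δ-pred u u₀) (λ k a → gather₅ k (δ p p₀) (δ i i₀) (δ v v₀) (δ d d₀) a))
      where
      move : ∀ k l {a b Y} {F : ℕ → ℕ → ℕ} → k * a ≡ l * b → (∀ k a → F k a ≡ (k * a) * Y) → F k a ≡ F l b
      move k l {a} {b} {Y} eq gather = trans (gather k a) (trans (cong (_* Y) eq) (sym (gather l b)))

      gather₂ : ∀ k x a y → k * (x * (a * y)) ≡ (k * a) * (x * y)
      gather₂ = solve-∀

      gather₄ : ∀ k x y z a w → k * (x * (y * (z * (a * w)))) ≡ (k * a) * (x * (y * (z * w)))
      gather₄ = solve-∀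

      gather₅ : ∀ k x y z w a → k * (x * (y * (z * (w * a)))) ≡ (k * a) * (x * (y * (z * w)))
      gather₅ = solve-∀

    at-valley : ∀ Y → v * (δ p p₀ * (δ i i₀ * (δ v v₀ * Y))) ≡ v₀ * (δ p p₀ * (δ i i₀ * (δ v v₀ * Y)))
    at-valley Y = trans (gather v (δ p p₀) (δ i i₀) (δ v v₀) Y)
      (trans (cong (_* (δ p p₀ * δ i i₀ * Y)) (δ-* id v v₀)) (sym (gather v₀ (δ p p₀) (δ i i₀) (δ v v₀) Y)))
      where
      gather : ∀ v a b c y → v * (a * (b * (c * y))) ≡ (v * c) * (a * b * y)
      gather = solve-∀

    new-desc : ∀ d₀ → v * point p₀ i₀ v₀ d₀ u₀ p i v (suc d) u ≡ v₀ * pre (λ d₀ → P p₀ i₀ v₀ d₀ u₀) d₀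
    new-desc zero     = trans (at-valley 0) (zeros v₀ (δ p p₀) (δ i i₀) (δ v v₀))
      where
      zeros : ∀ v a b c → v * (a * (b * (c * 0))) ≡ v * 0
      zeros = solve-∀
    new-desc (suc d₀) = at-valley (δ d d₀ * δ u u₀)

    new-asc : ∀ u₀ → v * point p₀ i₀ v₀ d₀ u₀ p i v d (suc u) ≡ v₀ * pre (λ u₀ → P p₀ i₀ v₀ d₀ u₀) u₀
    new-asc zero     = trans (at-valley (δ d d₀ * 0)) (zeros v₀ (δ p p₀) (δ i i₀) (δ v v₀) (δ d d₀))
      where
      zeros : ∀ v a b c d → v * (a * (b * (c * (d * 0)))) ≡ v * 0
      zeros = solve-∀
    new-asc (suc u₀) = at-valley (δ d d₀ * δ u u₀)

    suc-pred : ∀ (F : ℕ → ℕ) v → v * F (suc (v ∸ 1)) ≡ v * F v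
    suc-pred F zero    = refl
    suc-pred F (suc v) = refl

    new-monotone :
      v * (point p₀ i₀ v₀ d₀ u₀ p i v d (suc u) + point p₀ i₀ v₀ d₀ u₀ p i v (suc d) u)
      + v * (point p₀ i₀ v₀ d₀ u₀ p i (suc (v ∸ 1)) (suc d) u + point p₀ i₀ v₀ d₀ u₀ p i (suc (v ∸ 1)) d (suc u))
      ≡ 2 * (v₀ * (pre (λ d₀ → P p₀ i₀ v₀ d₀ u₀) d₀ + pre (λ u₀ → P p₀ i₀ v₀ d₀ u₀) u₀))
    new-monotone = begin
      v * (asc↓ v + desc↓ v) + v * (desc↓ (suc (v ∸ 1)) + asc↓ (suc (v ∸ 1)))
        ≡⟨ cong (v * (asc↓ v + desc↓ v) ℕ.+_) (suc-pred (λ v → desc↓ v + asc↓ v) v) ⟩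
      v * (asc↓ v + desc↓ v) + v * (desc↓ v + asc↓ v)
        ≡⟨ regroup v (asc↓ v) (desc↓ v) ⟩
      2 * (v * desc↓ v + v * asc↓ v)
        ≡⟨ cong (2 *_) (cong₂ _+_ (new-desc d₀) (new-asc u₀)) ⟩
      2 * (v₀ * pre (λ d₀ → P p₀ i₀ v₀ d₀ u₀) d₀ + v₀ * pre (λ u₀ → P p₀ i₀ v₀ d₀ u₀) u₀)
        ≡⟨ cong (2 *_) (ℕ.*-distribˡ-+ v₀ (pre (λ d₀ → P p₀ i₀ v₀ d₀ u₀) d₀) (pre (λ u₀ → P p₀ i₀ v₀ d₀ u₀) u₀)) ⟨
      2 * (v₀ * (pre (λ d₀ → P p₀ i₀ v₀ d₀ u₀) d₀ + pre (λ u₀ → P p₀ i₀ v₀ d₀ u₀) u₀)) ∎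
      where
      open ≡-Reasoning
      asc↓ desc↓ : ℕ → ℕ
      asc↓ v = point p₀ i₀ v₀ d₀ u₀ p i v d (suc u)
      desc↓ v = point p₀ i₀ v₀ d₀ u₀ p i v (suc d) u
      regroup : ∀ v a d → v * (a + d) + v * (d + a) ≡ 2 * (v * d + v * a)
      regroup = solve-∀

number : ∀ n → Weight
number n p i v d u = sumCode {n} (λ c → at# (point p i v d u) (# c))

number-suc : ∀ n p i v d u → number (suc n) p i v d u ≡ spread (number n) p i v d u
number-suc n p i v d u = begin
  sumCode {n} (extend λ c → at# (point p i v d u) (# c))
    ≡⟨ sumCode-cong {n} (λ c → trans (extend-at# (point p i v d u) c) (grow-point ((# c) posFix) ((# c) negFix) ((# c) valley) ((# c) desc) ((# c) asc) p i v d u)) ⟩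
  sumCode {n} (λ c → (Xp c + Xi c) + (2 * Xv c + 2 * (v * (Xd c + Xu c))))
    ≡⟨ sumCode-+ (λ c → Xp c + Xi c) (λ c → 2 * Xv c + 2 * (v * (Xd c + Xu c))) ⟩
  sumCode (λ c → Xp c + Xi c) + sumCode (λ c → 2 * Xv c + 2 * (v * (Xd c + Xu c)))
    ≡⟨ cong₂ _+_ (sumCode-+ Xp Xi) (sumCode-+ (λ c → 2 * Xv c) (λ c → 2 * (v * (Xd c + Xu c)))) ⟩
  (sumCode Xp + sumCode Xi) + (sumCode (λ c → 2 * Xv c) + sumCode (λ c → 2 * (v * (Xd c + Xu c))))
    ≡⟨ cong₂ _+_
         (cong₂ _+_ (sumCode-pre (λ p c → X c p i v d u) p) (sumCode-pre (λ i c → X c p i v d u) i))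
         (cong₂ _+_ (trans (sumCode-* 2 Xv) (cong (2 *_) (trans (sumCode-pre Xv′ v) (pre-cong sum-Xv′ v))))
                    (trans (sumCode-* 2 (λ c → v * (Xd c + Xu c))) (cong (2 *_)
                      (trans (sumCode-* v (λ c → Xd c + Xu c)) (cong (v *_) (trans (sumCode-+ Xd Xu)
                        (cong₂ _+_ (sumCode-pre (λ d c → X c p i v d u) d) (sumCode-pre (λ u c → X c p i v d u) u)))))))) ⟩
  spread (number n) p i v d u ∎
  where
  open ≡-Reasoning
  X : Code n → Weight
  X c p i v d u = at# (point p i v d u) (# c)
  Xp Xi Xv Xd Xu : Code n → ℕ
  Xv′ : ℕ → Code n → ℕ
  Xp c = pre (λ p → X c p i v d u) p
  Xi c = pre (λ i → X c p i v d u) i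
  Xd c = pre (λ d → X c p i v d u) d
  Xu c = pre (λ u → X c p i v d u) u
  Xv′ v c = suc p * X c (suc p) i v d u + suc i * X c p (suc i) v d u
          + suc d * X c p i v (suc d) u + suc u * X c p i v d (suc u)
  Xv c = pre (λ v → Xv′ v c) v

  sum-Xv′ : ∀ v → sumCode (Xv′ v) ≡ suc p * number n (suc p) i v d u + suc i * number n p (suc i) v d u
                                  + suc d * number n p i v (suc d) u + suc u * number n p i v d (suc u)
  sum-Xv′ v =
    trans (sumCode-+ (λ c → suc p * X c (suc p) i v d u + suc i * X c p (suc i) v d u
                          + suc d * X c p i v (suc d) u) (λ c → suc u * X c p i v d (suc u)))
    (cong₂ _+_
      (trans (sumCode-+ (λ c → suc p * X c (suc p) i v d u + suc i * X c p (suc i) v d u) (λ c → suc d * X c p i v (suc d) u))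
      (cong₂ _+_
        (trans (sumCode-+ (λ c → suc p * X c (suc p) i v d u) (λ c → suc i * X c p (suc i) v d u))
        (cong₂ _+_ (sumCode-* (suc p) (λ c → X c (suc p) i v d u)) (sumCode-* (suc i) (λ c → X c p (suc i) v d u))))
        (sumCode-* (suc d) (λ c → X c p i v (suc d) u))))
      (sumCode-* (suc u) (λ c → X c p i v d (suc u))))

-- Splitting the count by binomial coefficients

-- bin a b is the binomial coefficient (a + b choose a).
bin : ℕ → ℕ → ℕ
bin zero    b       = 1
bin (suc a) zero    = 1
bin (suc a) (suc b) = bin a (suc b) + bin (suc a) b

bin-0ʳ : ∀ a → bin a 0 ≡ 1
bin-0ʳ zero    = refl
bin-0ʳ (suc a) = refl

-- The two absorption identities support each other: Pascal's rule yields two terms, and both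
-- identities at smaller arguments carry one term into the shape of the other.
bin-sucˡ : ∀ a b → suc a * bin (suc a) b ≡ suc (a + b) * bin a b
bin-sucʳ : ∀ a b → suc b * bin a (suc b) ≡ suc (a + b) * bin a b
bin-sucˡ a zero rewrite bin-0ʳ a | ℕ.+-identityʳ a = refl
bin-sucˡ a (suc b) = begin
  suc a * (bin a (suc b) + bin (suc a) b)                 ≡⟨ ℕ.*-distribˡ-+ (suc a) (bin a (suc b)) (bin (suc a) b) ⟩
  suc a * bin a (suc b) + suc a * bin (suc a) b           ≡⟨ cong (suc a * bin a (suc b) ℕ.+_) (trans (bin-sucˡ a b) (sym (bin-sucʳ a b))) ⟩
  suc a * bin a (suc b) + suc b * bin a (suc b)           ≡⟨ collect a b (bin a (suc b)) ⟩
  suc (a + suc b) * bin a (suc b)                         ∎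
  where
  open ≡-Reasoning
  collect : ∀ a b x → suc a * x + suc b * x ≡ suc (a + suc b) * x
  collect = solve-∀
bin-sucʳ zero    b = refl
bin-sucʳ (suc a) b = begin
  suc b * (bin a (suc b) + bin (suc a) b)                 ≡⟨ ℕ.*-distribˡ-+ (suc b) (bin a (suc b)) (bin (suc a) b) ⟩
  suc b * bin a (suc b) + suc b * bin (suc a) b           ≡⟨ cong (_+ suc b * bin (suc a) b) (trans (bin-sucʳ a b) (sym (bin-sucˡ a b))) ⟩
  suc a * bin (suc a) b + suc b * bin (suc a) b           ≡⟨ collect a b (bin (suc a) b) ⟩
  suc (suc a + b) * bin (suc a) b                         ∎
  where
  open ≡-Reasoning
  collect : ∀ a b x → suc a * x + suc b * x ≡ suc (suc a + b) * x
  collect = solve-∀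

-- Pascal's rule: lowering either argument gives the same sum `a + b`, so the factor `X` is common
-- to both terms.
bin-pre : ∀ X a b → pre (λ a → bin a b * X (a + b)) a + pre (λ b → bin a b * X (a + b)) b ≡ bin a b * pre X (a + b)
bin-pre X zero    zero    = refl
bin-pre X zero    (suc b) = refl
bin-pre X (suc a) zero    rewrite bin-0ʳ a = ℕ.+-identityʳ (X (a + 0) + 0)
bin-pre X (suc a) (suc b) rewrite ℕ.+-suc a b = sym (ℕ.*-distribʳ-+ (X (suc (a + b))) (bin a (suc b)) (bin (suc a) b))

-- By absorption the two summands are equal. This is the doubling that turns the 2 for the sign of
-- the new letter into the 4 of the recurrence of `g`.
bin-suc : ∀ (X : ℕ → ℕ) a b → suc a * (bin (suc a) b * X (suc a + b)) + suc b * (bin a (suc b) * X (a + suc b))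
                   ≡ 2 * (bin a b * (suc (a + b) * X (suc (a + b))))
bin-suc X a b rewrite ℕ.+-suc a b = begin
  suc a * (bin (suc a) b * x) + suc b * (bin a (suc b) * x)
    ≡⟨ cong₂ _+_ (ℕ.*-assoc (suc a) (bin (suc a) b) x) (ℕ.*-assoc (suc b) (bin a (suc b)) x) ⟨
  suc a * bin (suc a) b * x + suc b * bin a (suc b) * x
    ≡⟨ cong₂ (λ y z → y * x + z * x) (bin-sucˡ a b) (bin-sucʳ a b) ⟩
  suc (a + b) * bin a b * x + suc (a + b) * bin a b * x
    ≡⟨ collect (suc (a + b)) (bin a b) x ⟩
  2 * (bin a b * (suc (a + b) * x)) ∎
  where
  open ≡-Reasoning
  x = X (suc (a + b))
  collect : ∀ m y x → m * y * x + m * y * x ≡ 2 * (y * (m * x))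
  collect = solve-∀

bin-δ : ∀ a b → δ 0 a * δ 0 b ≡ bin a b * δ 0 (a + b)
bin-δ zero    zero    = refl
bin-δ zero    (suc b) = refl
bin-δ (suc a) b       = sym (ℕ.*-zeroʳ (bin (suc a) b))

-- What remains of `spread` after the binomial factors are divided out: `m` is the number of fixed
-- points of both signs, `s` that of double ascents and double descents together. The last 2 counts
-- the origin of a new monotone node, which was a peak or a valley.
b : ℕ → ℕ → ℕ → ℕ → ℕ
b zero    m v s = δ 0 m * (δ 0 v * δ 0 s)
b (suc n) m v s = pre (λ m → b n m v s) m
  + (4 * pre (λ v → suc m * b n (suc m) v s + suc s * b n m v (suc s)) v
  + 2 * (v * pre (λ s → b n m v s) s))

split-sum : ∀ n p i v d u → number n p i v d u ≡ bin p i * (bin d u * b n (p + i) v (d + u))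
split-sum zero p i v d u = begin
  δ 0 p * (δ 0 i * (δ 0 v * (δ 0 d * δ 0 u)))
    ≡⟨ gather (δ 0 p) (δ 0 i) (δ 0 v) (δ 0 d) (δ 0 u) ⟩
  (δ 0 p * δ 0 i) * (δ 0 v * (δ 0 d * δ 0 u))
    ≡⟨ cong₂ (λ x y → x * (δ 0 v * y)) (bin-δ p i) (bin-δ d u) ⟩
  (bin p i * δ 0 (p + i)) * (δ 0 v * (bin d u * δ 0 (d + u)))
    ≡⟨ scatter (bin p i) (δ 0 (p + i)) (δ 0 v) (bin d u) (δ 0 (d + u)) ⟩
  bin p i * (bin d u * (δ 0 (p + i) * (δ 0 v * δ 0 (d + u)))) ∎
  where
  open ≡-Reasoning
  gather : ∀ p i v d u → p * (i * (v * (d * u))) ≡ (p * i) * (v * (d * u))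
  gather = solve-∀
  scatter : ∀ x p v y d → (x * p) * (v * (y * d)) ≡ x * (y * (p * (v * d)))
  scatter = solve-∀
split-sum (suc n) p i v d u = begin
  number (suc n) p i v d u
    ≡⟨ number-suc n p i v d u ⟩
  spread (number n) p i v d u
    ≡⟨ cong₂ _+_
        (cong₂ _+_ (pre-cong (λ p → split-sum n p i v d u) p) (pre-cong (λ i → split-sum n p i v d u) i))
        (cong₂ _+_
          (cong (2 *_) (pre-cong (λ v → cong₂ _+_ (cong₂ _+_ (cong₂ _+_
            (cong (suc p *_) (split-sum n (suc p) i v d u)) (cong (suc i *_) (split-sum n p (suc i) v d u)))
            (cong (suc d *_) (split-sum n p i v (suc d) u))) (cong (suc u *_) (split-sum n p i v d (suc u)))) v))
          (cong (2 *_) (cong (v *_) (cong₂ _+_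
            (pre-cong (λ d → split-sum n p i v d u) d) (pre-cong (λ u → split-sum n p i v d u) u))))) ⟩
  spread Y p i v d u
    ≡⟨ cong₂ _+_ fixed-part (cong₂ _+_ (cong (2 *_) valley-part) (cong (2 *_) (cong (v *_) monotone-part))) ⟩
  x * (y * pre (λ m → b n m v s) m) +
    (2 * (2 * (x * (y * pre (λ v → suc m * b n (suc m) v s + suc s * b n m v (suc s)) v)))
    + 2 * (v * (x * (y * pre (λ s → b n m v s) s))))
    ≡⟨ collect x y (pre (λ m → b n m v s) m) (pre (λ v → suc m * b n (suc m) v s + suc s * b n m v (suc s)) v) v
         (pre (λ s → b n m v s) s) ⟩
  x * (y * b (suc n) m v s) ∎
  where
  open ≡-Reasoning
  x = bin p i
  y = bin d u
  m = p + i
  s = d + u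
  Y : Weight
  Y p i v d u = bin p i * (bin d u * b n (p + i) v (d + u))

  collect : ∀ x y a b v c → x * (y * a) + (2 * (2 * (x * (y * b))) + 2 * (v * (x * (y * c))))
                          ≡ x * (y * (a + (4 * b + 2 * (v * c))))
  collect = solve-∀

  fixed-part : pre (λ p → Y p i v d u) p + pre (λ i → Y p i v d u) i ≡ x * (y * pre (λ m → b n m v s) m)
  fixed-part = trans (bin-pre (λ m → y * b n m v s) p i) (cong (x *_) (pre-* y (λ m → b n m v s) m))

  monotone-part : pre (λ d → Y p i v d u) d + pre (λ u → Y p i v d u) u ≡ x * (y * pre (λ s → b n m v s) s)
  monotone-part = trans
    (cong₂ _+_ (pre-* x (λ d → bin d u * b n m v (d + u)) d) (pre-* x (λ u → bin d u * b n m v (d + u)) u))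
    (trans (sym (ℕ.*-distribˡ-+ x (pre (λ d → bin d u * b n m v (d + u)) d) (pre (λ u → bin d u * b n m v (d + u)) u)))
      (cong (x *_) (bin-pre (λ s → b n m v s) d u)))

  valley-part : pre (λ v → suc p * Y (suc p) i v d u + suc i * Y p (suc i) v d u
                         + suc d * Y p i v (suc d) u + suc u * Y p i v d (suc u)) v
    ≡ 2 * (x * (y * pre (λ v → suc m * b n (suc m) v s + suc s * b n m v (suc s)) v))
  valley-part = trans (pre-cong step v)
    (trans (pre-* 2 (λ v → x * (y * F v)) v)
      (cong (2 *_) (trans (pre-* x (λ v → y * F v) v) (cong (x *_) (pre-* y F v)))))
    where
    F : ℕ → ℕ
    F v = suc m * b n (suc m) v s + suc s * b n m v (suc s)

    step : ∀ v → suc p * Y (suc p) i v d u + suc i * Y p (suc i) v d u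
               + suc d * Y p i v (suc d) u + suc u * Y p i v d (suc u) ≡ 2 * (x * (y * F v))
    step v = trans (pull (suc p * Y (suc p) i v d u) (suc i * Y p (suc i) v d u) x (suc d) (suc u)
                      (bin (suc d) u * b n m v (suc d + u)) (bin d (suc u) * b n m v (d + suc u)))
      (trans (cong₂ (λ z w → z + x * w) (bin-suc (λ m → y * b n m v s) p i) (bin-suc (λ s → b n m v s) d u))
        (join x y (suc m) (suc s) (b n (suc m) v s) (b n m v (suc s))))
      where
      pull : ∀ a c x k l z w → a + c + k * (x * z) + l * (x * w) ≡ (a + c) + x * (k * z + l * w)
      pull = solve-∀
      join : ∀ x y m s z w → 2 * (x * (m * (y * z))) + x * (2 * (y * (s * w))) ≡ 2 * (x * (y * (m * z + s * w)))
      join = solve-∀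

-- The numbers g

vanish : ∀ x y z {a b c d} → a ≡ + 0 → x ℤ.* b ≡ + 0 → c ≡ + 0 → z ℤ.* d ≡ + 0 →
         a ℤ.+ x ℤ.* b ℤ.+ y ℤ.* c ℤ.+ z ℤ.* d ≡ + 0
vanish x y z refl xb refl zd rewrite xb | zd | ℤ.*-zeroʳ y = refl

*-vanishʳ : ∀ x {b} → b ≡ + 0 → x ℤ.* b ≡ + 0
*-vanishʳ x refl = ℤ.*-zeroʳ x

*-vanishˡ : ∀ {x} b → x ≡ + 0 → x ℤ.* b ≡ + 0
*-vanishˡ b refl = ℤ.*-zeroˡ b

module _ (k : ℕ) (i j : ℤ) where
  c₂ c₃ c₄ : ℤ
  c₂ = (+ 4) ℤ.* (+ 1 ℤ.+ i)
  c₃ = (+ 2) ℤ.* j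
  c₄ = (+ 4) ℤ.* (+ (suc k + 2) ℤ.- i ℤ.- (+ 2) ℤ.* j)

g-neg-i : ∀ k a j → g (suc k) -[1+ a ] j ≡ + 0
g-neg-i zero    a j = refl
g-neg-i (suc k) a j = vanish (c₂ k i j) (c₃ k i j) (c₄ k i j)
  (g-neg-i k _ j) (next a) (g-neg-i k a j) (*-vanishʳ (c₄ k i j) (g-neg-i k a (j ℤ.- + 1)))
  where
  i = -[1+ a ]
  next : ∀ a → c₂ k -[1+ a ] j ℤ.* g (suc k) (-[1+ a ] ℤ.+ + 1) (j ℤ.- + 1) ≡ + 0
  -- At i = -1 the coefficient 4(1 + i) is zero, which keeps the values at i = 0 from spreading to
  -- negative i.
  next zero    = ℤ.*-zeroˡ (g (suc k) (+ 0) (j ℤ.- + 1))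
  next (suc a) = *-vanishʳ (c₂ k -[1+ suc a ] j) (g-neg-i k a (j ℤ.- + 1))

g-neg-j : ∀ k i a → g (suc k) i -[1+ a ] ≡ + 0
g-neg-j zero    i a = cong (λ t → if t then + 1 else + 0) (Bool.∧-zeroʳ ⌊ i ℤ.≟ + 1 ⌋)
g-neg-j (suc k) i a = vanish (c₂ k i -[1+ a ]) (c₃ k i -[1+ a ]) (c₄ k i -[1+ a ])
  (g-neg-j k _ a) (*-vanishʳ (c₂ k i -[1+ a ]) (g-neg-j k _ _)) (g-neg-j k i a)
  (*-vanishʳ (c₄ k i -[1+ a ]) (g-neg-j k i _))

-- For size `suc k + 1` with d double descents, `s` is `suc d`; the case `s = 0` is the first
-- diagonal beyond the support.
c₄-value : ∀ k i j s → i + 2 * j + s ≡ suc k + 2 → + (suc k + 2) ℤ.- + i ℤ.- (+ 2) ℤ.* + j ≡ + s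
c₄-value k i j s eq = begin
  + (suc k + 2) ℤ.- + i ℤ.- + 2 ℤ.* + j                       ≡⟨ cong (λ t → + t ℤ.- + i ℤ.- + 2 ℤ.* + j) eq ⟨
  (+ i ℤ.+ + (2 * j) ℤ.+ + s) ℤ.- + i ℤ.- + 2 ℤ.* + j         ≡⟨ cong (λ t → (+ i ℤ.+ t ℤ.+ + s) ℤ.- + i ℤ.- + 2 ℤ.* + j) (ℤ.pos-* 2 j) ⟩
  (+ i ℤ.+ + 2 ℤ.* + j ℤ.+ + s) ℤ.- + i ℤ.- + 2 ℤ.* + j       ≡⟨ cancel (+ i) (+ 2 ℤ.* + j) (+ s) ⟩
  + s                                                         ∎
  where
  open ≡-Reasoning
  cancel : ∀ x y z → (x ℤ.+ y ℤ.+ z) ℤ.- x ℤ.- y ≡ z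
  cancel = IntRing.solve-∀

two-more : ∀ i j s → i + 2 * suc j + s ≡ suc (suc (i + 2 * j + s))
two-more = solve-∀

two-more′ : ∀ i j → i + 2 * suc j ≡ suc (suc (i + 2 * j))
two-more′ = solve-∀

-- A step that raises j by one and keeps i increases i + 2j by two while the size grows by one, so
-- it could leave the region i + 2j ≤ n. It does so only on the diagonal where its coefficient is
-- zero.
g-big : ∀ k i j → suc k ℕ.< i + 2 * j → g (suc k) (+ i) (+ j) ≡ + 0
g-big zero i             (suc j) big = cong (λ t → if t then + 1 else + 0) (Bool.∧-zeroʳ ⌊ + i ℤ.≟ + 1 ⌋)
g-big zero (suc (suc i)) zero    big = refl
g-big zero (suc zero)    zero    (ℕ.s≤s ())
g-big (suc k) i j big = vanish (c₂ k (+ i) (+ j)) (c₃ k (+ i) (+ j)) (c₄ k (+ i) (+ j))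
  (first i big) (*-vanishʳ (c₂ k (+ i) (+ j)) (second j big))
  (g-big k i j (ℕ.<⇒≤ big)) (fourth j big)
  where
  first : ∀ i → suc (suc k) ℕ.< i + 2 * j → g (suc k) (+ i ℤ.- + 1) (+ j) ≡ + 0
  first zero    big = g-neg-i k 0 (+ j)
  first (suc i) big = g-big k i j (ℕ.s≤s⁻¹ big)

  second : ∀ j → suc (suc k) ℕ.< i + 2 * j → g (suc k) (+ i ℤ.+ + 1) (+ j ℤ.- + 1) ≡ + 0
  second zero    big = g-neg-j k (+ i ℤ.+ + 1) 0
  second (suc j) big = trans (cong (λ t → g (suc k) (+ t) (+ j)) (ℕ.+-comm i 1))
    (g-big k (suc i) j (ℕ.s≤s⁻¹ (subst (suc (suc k) ℕ.<_) (two-more′ i j) big)))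

  fourth : ∀ j → suc (suc k) ℕ.< i + 2 * j → c₄ k (+ i) (+ j) ℤ.* g (suc k) (+ i) (+ j ℤ.- + 1) ≡ + 0
  fourth zero    big = *-vanishʳ (c₄ k (+ i) (+ 0)) (g-neg-j k (+ i) 0)
  fourth (suc j) big with ℕ.m≤n⇒m<n∨m≡n (ℕ.s≤s⁻¹ (ℕ.s≤s⁻¹ (subst (suc (suc k) ℕ.<_) (two-more′ i j) big)))
  ... | inj₁ big′ = *-vanishʳ (c₄ k (+ i) (+ suc j)) (g-big k i j big′)
  ... | inj₂ eq   = *-vanishˡ (g (suc k) (+ i) (+ j)) (cong (λ t → + 4 ℤ.* t) (c₄-value k i (suc j) 0 edge))
    where
    edge : i + 2 * suc j + 0 ≡ suc k + 2
    edge = trans (two-more i j 0) (trans (cong (2 ℕ.+_) (trans (ℕ.+-identityʳ _) (sym eq))) (ℕ.+-comm 2 (suc k)))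

g-value : ∀ k i j s → i + 2 * j + s ≡ suc k → g (suc k) (+ i) (+ j) ≡ + b (suc k) i j s
g-value zero zero          zero    (suc zero) eq = refl
g-value zero (suc zero)    zero    zero       eq = refl
g-value zero i             (suc j) s          eq = contradiction (trans (sym (two-more i j s)) eq) λ ()
g-value (suc k) i j s eq = begin
  g N (+ i ℤ.- + 1) (+ j) ℤ.+ c₂ k (+ i) (+ j) ℤ.* g N (+ i ℤ.+ + 1) (+ j ℤ.- + 1)
    ℤ.+ c₃ k (+ i) (+ j) ℤ.* g N (+ i) (+ j) ℤ.+ c₄ k (+ i) (+ j) ℤ.* g N (+ i) (+ j ℤ.- + 1)
    ≡⟨ cong₂ ℤ._+_ (cong₂ ℤ._+_ (cong₂ ℤ._+_ (first i eq) (cong (λ t → c₂ k (+ i) (+ j) ℤ.* t) (second j eq)))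
         (cong (λ t → c₃ k (+ i) (+ j) ℤ.* t) (third s eq))) (cong₂ (λ x y → + 4 ℤ.* x ℤ.* y) (c₄-value k i j (suc s) total) (fourth j eq)) ⟩
  + B₁ ℤ.+ + 4 ℤ.* + suc i ℤ.* + B₂ ℤ.+ + 2 ℤ.* + j ℤ.* + B₃ ℤ.+ + 4 ℤ.* + suc s ℤ.* + B₄
    ≡⟨ regroup (+ B₁) (+ suc i) (+ B₂) (+ j) (+ B₃) (+ suc s) (+ B₄) ⟩
  + B₁ ℤ.+ (+ 4 ℤ.* (+ suc i ℤ.* + B₂ ℤ.+ + suc s ℤ.* + B₄) ℤ.+ + 2 ℤ.* (+ j ℤ.* + B₃))
    ≡⟨ cong (λ t → + B₁ ℤ.+ t) (cong₂ ℤ._+_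
         (trans (ℤ.pos-* 4 (suc i * B₂ + suc s * B₄)) (cong (λ t → + 4 ℤ.* t) (trans (ℤ.pos-+ (suc i * B₂) (suc s * B₄)) (cong₂ ℤ._+_ (ℤ.pos-* (suc i) B₂) (ℤ.pos-* (suc s) B₄)))))
         (trans (ℤ.pos-* 2 (j * B₃)) (cong (λ t → + 2 ℤ.* t) (ℤ.pos-* j B₃)))) ⟨
  + (B₁ + (4 * (suc i * B₂ + suc s * B₄) + 2 * (j * B₃)))
    ≡⟨ cong (λ t → + (B₁ + (4 * t + 2 * (j * B₃)))) (pre-+ j) ⟩
  + b (suc N) i j s ∎
  where
  open ≡-Reasoning
  N  = suc k
  B₁ = pre (λ m → b N m j s) i
  B₂ = pre (λ v → b N (suc i) v s) j
  B₃ = pre (λ s → b N i j s) s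
  B₄ = pre (λ v → b N i v (suc s)) j

  total : i + 2 * j + suc s ≡ suc k + 2
  total = trans (ℕ.+-suc (i + 2 * j) s) (trans (cong suc eq) (ℕ.+-comm 2 (suc k)))

  pre-+ : ∀ j → suc i * pre (λ v → b N (suc i) v s) j + suc s * pre (λ v → b N i v (suc s)) j
        ≡ pre (λ v → suc i * b N (suc i) v s + suc s * b N i v (suc s)) j
  pre-+ zero    = cong₂ _+_ (ℕ.*-zeroʳ (suc i)) (ℕ.*-zeroʳ (suc s))
  pre-+ (suc j) = refl

  regroup : ∀ a m b j c s d → a ℤ.+ + 4 ℤ.* m ℤ.* b ℤ.+ + 2 ℤ.* j ℤ.* c ℤ.+ + 4 ℤ.* s ℤ.* d
    ≡ a ℤ.+ (+ 4 ℤ.* (m ℤ.* b ℤ.+ s ℤ.* d) ℤ.+ + 2 ℤ.* (j ℤ.* c))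
  regroup = IntRing.solve-∀

  -- Each default value 0 of `pre` has to be matched by a zero of `g`: at negative i, at negative j,
  -- and, for `s = 0`, at i + 2j beyond the size.
  first : ∀ i → i + 2 * j + s ≡ suc N → g N (+ i ℤ.- + 1) (+ j) ≡ + pre (λ m → b N m j s) i
  first zero    eq = g-neg-i k 0 (+ j)
  first (suc i) eq = g-value k i j s (ℕ.suc-injective eq)

  second : ∀ j → i + 2 * j + s ≡ suc N → g N (+ i ℤ.+ + 1) (+ j ℤ.- + 1) ≡ + pre (λ v → b N (suc i) v s) j
  second zero    eq = g-neg-j k (+ i ℤ.+ + 1) 0
  second (suc j) eq = trans (cong (λ t → g N (+ t) (+ j)) (ℕ.+-comm i 1))
    (g-value k (suc i) j s (ℕ.suc-injective (trans (sym (two-more i j s)) eq)))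

  third : ∀ s → i + 2 * j + s ≡ suc N → g N (+ i) (+ j) ≡ + pre (λ s → b N i j s) s
  third zero    eq = g-big k i j (ℕ.≤-reflexive (trans (sym eq) (ℕ.+-identityʳ _)))
  third (suc s) eq = g-value k i j s (ℕ.suc-injective (trans (sym (ℕ.+-suc (i + 2 * j) s)) eq))

  fourth : ∀ j → i + 2 * j + s ≡ suc N → g N (+ i) (+ j ℤ.- + 1) ≡ + pre (λ v → b N i v (suc s)) j
  fourth zero    eq = g-neg-j k (+ i) 0
  fourth (suc j) eq = g-value k i j (suc s)
    (trans (ℕ.+-suc (i + 2 * j) s) (ℕ.suc-injective (trans (sym (two-more i j s)) eq)))

-- Statistics of the encoded permutation

all-tabulate⁻ : (p : A → Bool) (f : Fin n → A) → all p (List.tabulate f) ≡ true → ∀ i → p (f i) ≡ true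
all-tabulate⁻ {n = suc n} p f eq i with p (f zero) in p0
all-tabulate⁻ {n = suc n} p f eq zero    | true = p0
all-tabulate⁻ {n = suc n} p f eq (suc i) | true = all-tabulate⁻ p (f ∘ suc) eq i

all-tabulate⁺ : (p : A → Bool) (f : Fin n → A) → (∀ i → p (f i) ≡ true) → all p (List.tabulate f) ≡ true
all-tabulate⁺ {n = zero}  p f eq = refl
all-tabulate⁺ {n = suc n} p f eq rewrite eq zero = all-tabulate⁺ p (f ∘ suc) (eq ∘ suc)

length-filterᵇ : (p : A → Bool) (f : Fin n → A) →
                 List.length (List.filterᵇ p (List.tabulate f)) ≡ sum (λ i → ⟦ p (f i) ⟧)
length-filterᵇ {n = zero}  p f = refl
length-filterᵇ {n = suc n} p f with p (f zero)
... | true  = cong suc (length-filterᵇ p (f ∘ suc))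
... | false = length-filterᵇ p (f ∘ suc)

countᶠ-sum : (p : Fin n → Bool) → countᶠ p ≡ sum (λ i → ⟦ p i ⟧)
countᶠ-sum p = length-filterᵇ p id

sum≡0⁻ : (t : Fin n → ℕ) → sum t ≡ 0 → ∀ i → t i ≡ 0
sum≡0⁻ t eq i = ℕ.n≤0⇒n≡0 (ℕ.≤-trans (term≤sum t i) (ℕ.≤-reflexive eq))

sum≡0⁺ : (t : Fin n → ℕ) → (∀ i → t i ≡ 0) → sum t ≡ 0
sum≡0⁺ {n} t eq = trans (sum-cong-≗ eq) (sum-replicate-zero n)

⟦⟧≡0⁻ : ∀ {x} → ⟦ x ⟧ ≡ 0 → x ≡ false
⟦⟧≡0⁻ {false} eq = refl

injective : (π : SArr n) → isBn π ≡ true → Injective _≡_ _≡_ (absMap π)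
injective {n} π eq {i} {j} fi≡fj with absMap π i ≟ absMap π j | i ≟ j
  | all-tabulate⁻ (λ j → not ⌊ absMap π i ≟ absMap π j ⌋ ∨ ⌊ i ≟ j ⌋) id
      (all-tabulate⁻ (λ i → all (λ j → not ⌊ absMap π i ≟ absMap π j ⌋ ∨ ⌊ i ≟ j ⌋) (List.allFin n)) id eq i) j
... | _       | yes i≡j | _  = i≡j
... | no fi≢fj | no _    | _  = contradiction fi≡fj fi≢fj
... | yes _   | no _    | ()

isBn-injective : (π : SArr n) → Injective _≡_ _≡_ (absMap π) → isBn π ≡ true
isBn-injective π inj = all-tabulate⁺ _ id λ i → all-tabulate⁺ _ id λ j → distinct i j
  where
  distinct : ∀ i j → (not ⌊ absMap π i ≟ absMap π j ⌋ ∨ ⌊ i ≟ j ⌋) ≡ true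
  distinct i j with absMap π i ≟ absMap π j | i ≟ j
  ... | no _      | _      = refl
  ... | yes _     | yes _  = refl
  ... | yes fi≡fj | no i≢j = contradiction (inj fi≡fj) i≢j

arr : Code n → SArr n
arr c = tabulate (ent c)

val-abs : ∀ {e e′ : SEntry n} → val e ≡ val e′ → proj₂ e ≡ proj₂ e′
val-abs {e = false , y} {false , z} eq = toℕ-injective (ℕ.suc-injective (ℤ.+-injective eq))
val-abs {e = true , y}  {true , z}  eq = toℕ-injective (ℤ.-[1+-injective eq)

module _ (c : Code n) where
  private
    π = arr c
    f = absMap π
    e = πv π

  absMap-arr : ∀ i → f i ≡ perm c i
  absMap-arr i = cong proj₂ (lookup∘tabulate (ent c) i)

  πv-arr : ∀ i → e i ≡ node c (perm c i)
  πv-arr i = trans (cong val (lookup∘tabulate (ent c) i)) (cong (λ s → val (s , perm c i)) (ent-sgn c i))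

  arr-injective : Injective _≡_ _≡_ f
  arr-injective {i} {j} eq = perm-injective c (trans (sym (absMap-arr i)) (trans eq (absMap-arr j)))

  isBn-arr : isBn π ≡ true
  isBn-arr = isBn-injective π arr-injective

  posFix-test : ∀ i → (kind c i == posFix) ≡ ⌊ e i ℤ.≟ + suc (toℕ i) ⌋
  posFix-test i with matches c i
  ... | moved p a b k rewrite k = sym (trans (cong (λ t → ⌊ t ℤ.≟ + suc (toℕ i) ⌋) (πv-arr i))
    (trans (⌊⌋-false (node c (perm c i) ℤ.≟ _) (λ eq → p (val-abs {e = _ , perm c i} {false , i} eq))) (sym (moved≠ a b))))
    where
    moved≠ : ∀ a b → (nd a b == posFix) ≡ false
    moved≠ false false = refl
    moved≠ false true  = refl
    moved≠ true  false = refl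
    moved≠ true  true  = refl
  ... | fixed p k rewrite k | πv-arr i | p with sgn c i
  ...   | false = sym (⌊⌋-true (+ suc (toℕ i) ℤ.≟ + suc (toℕ i)) refl)
  ...   | true  = refl

  negFix-test : ∀ i → (kind c i == negFix) ≡ ⌊ e i ℤ.≟ -[1+ toℕ i ] ⌋
  negFix-test i with matches c i
  ... | moved p a b k rewrite k = sym (trans (cong (λ t → ⌊ t ℤ.≟ -[1+ toℕ i ] ⌋) (πv-arr i))
    (trans (⌊⌋-false (node c (perm c i) ℤ.≟ _) (λ eq → p (val-abs {e = _ , perm c i} {true , i} eq))) (sym (moved≠ a b))))
    where
    moved≠ : ∀ a b → (nd a b == negFix) ≡ false
    moved≠ false false = refl
    moved≠ false true  = refl
    moved≠ true  false = refl
    moved≠ true  true  = refl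
  ... | fixed p k rewrite k | πv-arr i | p with sgn c i
  ...   | false = refl
  ...   | true  = sym (⌊⌋-true (-[1+ toℕ i ] ℤ.≟ -[1+ toℕ i ]) refl)

  single-arr : single π ≡ (# c) negFix
  single-arr = trans (countᶠ-sum (λ i → ⌊ e i ℤ.≟ -[1+ toℕ i ] ⌋))
    (sum-cong-≗ (λ i → cong ⟦_⟧ (sym (negFix-test i))))

  derangement⇒ : isDerangement π ≡ true → (# c) posFix ≡ 0
  derangement⇒ der = sum≡0⁺ _ λ i → cong ⟦_⟧ (trans (posFix-test i)
    (Bool.not-injective (all-tabulate⁻ (λ i → not ⌊ e i ℤ.≟ + suc (toℕ i) ⌋) id der i)))

  ⇒derangement : (# c) posFix ≡ 0 → isDerangement π ≡ true
  ⇒derangement none = all-tabulate⁺ _ id λ i →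
    cong not (trans (sym (posFix-test i)) (⟦⟧≡0⁻ (sum≡0⁻ (λ i → ⟦ kind c i == posFix ⟧) none i)))

  -- The entry at position `i` is the letter of the successor `perm c i`; hence the shift by one
  -- between positions and nodes, which `sum-perm` absorbs in the totals.
  ascent-test : ∀ i → ⌊ e i ℤ.<? e (f i) ⌋ ≡ out (kind c (perm c i))
  ascent-test i = begin
    ⌊ e i ℤ.<? e (f i) ⌋                              ≡⟨ cong₂ (λ x y → ⌊ x ℤ.<? y ⌋) (πv-arr i) (trans (cong e (absMap-arr i)) (πv-arr (perm c i))) ⟩
    ⌊ node c (perm c i) ℤ.<? node c (perm c (perm c i)) ⌋  ≡⟨ out-ascent c (perm c i) ⟨
    out (kind c (perm c i))                           ∎
    where open ≡-Reasoning

  wexc-arr : wexc π ≡ (# c) valley + (# c) asc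
  wexc-arr = begin
    wexc π                                           ≡⟨ countᶠ-sum (λ i → ⌊ e i ℤ.<? e (f i) ⌋) ⟩
    sum (λ i → ⟦ ⌊ e i ℤ.<? e (f i) ⌋ ⟧)             ≡⟨ sum-cong-≗ (λ i → cong ⟦_⟧ (trans (ascent-test i) (sym (into-out c (perm c i))))) ⟩
    sum (λ i → ⟦ into (kind c (perm c (perm c i))) ⟧) ≡⟨ sum-perm c (λ i → ⟦ into (kind c (perm c i)) ⟧) ⟩
    sum (λ i → ⟦ into (kind c (perm c i)) ⟧)         ≡⟨ sum-perm c (λ i → ⟦ into (kind c i) ⟧) ⟩
    sum (λ i → ⟦ into (kind c i) ⟧)                  ≡⟨ ascents c ⟩
    (# c) valley + (# c) asc                         ∎
    where open ≡-Reasoning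

  cda-arr⇒ : cda π ≡ 0 → (# c) asc ≡ 0
  cda-arr⇒ eq = begin
    sum (λ i → ⟦ kind c i == asc ⟧)                      ≡⟨ sum-perm c (λ i → ⟦ kind c i == asc ⟧) ⟨
    sum (λ i → ⟦ kind c (perm c i) == asc ⟧)             ≡⟨ sum-perm c (λ i → ⟦ kind c (perm c i) == asc ⟧) ⟨
    sum (λ i → ⟦ kind c (perm c (perm c i)) == asc ⟧)    ≡⟨ sum≡0⁺ _ not-asc ⟩
    0                                                    ∎
    where
    open ≡-Reasoning
    -- The middle entry of the triple that begins with `e i` belongs to the node
    -- `perm c (perm c i)`.
    not-asc : ∀ i → ⟦ kind c (perm c (perm c i)) == asc ⟧ ≡ 0
    not-asc i with kind c (perm c (perm c i)) in k
    ... | posFix = refl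
    ... | negFix = refl
    ... | valley = refl
    ... | peak   = refl
    ... | desc   = refl
    ... | asc    = ⊥-elim (cda≡0⇒noDoubleAscent π arr-injective eq i
      (⌊⌋-true⁻ (e i ℤ.<? e (f i))
        (trans (ascent-test i) (trans (sym (into-out c (perm c i))) (cong into k))))
      (⌊⌋-true⁻ (e (f i) ℤ.<? e (f (f i)))
        (trans (ascent-test (f i)) (trans (cong (out ∘ kind c ∘ perm c) (absMap-arr i)) (cong out k)))))

  ⇒cda-arr : (# c) asc ≡ 0 → cda π ≡ 0
  ⇒cda-arr none = noDoubleAscent⇒cda≡0 π arr-injective λ i up₁ up₂ →
    double-ascent (perm c (perm c i))
      (trans (into-out c (perm c i)) (trans (sym (ascent-test i)) (⌊⌋-true (e i ℤ.<? e (f i)) up₁)))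
      (trans (sym (trans (ascent-test (f i)) (cong (out ∘ kind c ∘ perm c) (absMap-arr i))))
        (⌊⌋-true (e (f i) ℤ.<? e (f (f i))) up₂))
    where
    double-ascent : ∀ y → into (kind c y) ≡ true → out (kind c y) ≡ true → ⊥
    double-ascent y in≡ out≡ with kind c y | sum≡0⁻ (λ i → ⟦ kind c i == asc ⟧) none y
    ... | asc    | ()
    ... | peak   | _ = contradiction (sym out≡) λ ()
    ... | valley | _ = contradiction (sym in≡) λ ()
    ... | desc   | _ = contradiction (sym in≡) λ ()
    ... | fx _   | _ = contradiction (sym in≡) λ ()

-- From sums over codes to bijections

Fin-sum-↔ : (t : Fin n → ℕ) → Fin (sum t) ↔ Σ (Fin n) (Fin ∘ t)
Fin-sum-↔ {zero}  t = mk↔ₛ′ (λ ()) (λ ()) (λ ()) (λ ())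
Fin-sum-↔ {suc n} t = ↔-trans (+↔⊎ {t zero}) (↔-trans (↔-refl ⊎-↔ Fin-sum-↔ (t ∘ suc)) (mk↔ₛ′ to from to-from from-to))
  where
  to : Fin (t zero) ⊎ Σ (Fin n) (Fin ∘ t ∘ suc) → Σ (Fin (suc n)) (Fin ∘ t)
  to (inj₁ a)       = zero , a
  to (inj₂ (i , a)) = suc i , a
  from : Σ (Fin (suc n)) (Fin ∘ t) → Fin (t zero) ⊎ Σ (Fin n) (Fin ∘ t ∘ suc)
  from (zero  , a) = inj₁ a
  from (suc i , a) = inj₂ (i , a)
  to-from : ∀ x → to (from x) ≡ x
  to-from (zero  , a) = refl
  to-from (suc i , a) = refl
  from-to : ∀ x → from (to x) ≡ x
  from-to (inj₁ a) = refl
  from-to (inj₂ a) = refl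

-- For an indicator `F` the right-hand side consists of the codes selected by `F`, so a number
-- computed as a sum becomes the size of a type.
Fin-sumCode-↔ : (F : Code n → ℕ) → Fin (sumCode F) ↔ Σ (Code n) (Fin ∘ F)
Fin-sumCode-↔ {zero} F = mk↔ₛ′ (nil ,_) (λ { (nil , a) → a }) (λ { (nil , a) → refl }) (λ _ → refl)
Fin-sumCode-↔ {suc n} F = ↔-trans (Fin-sumCode-↔ (extend F)) (↔-trans (Σ-↔ ↔-refl (λ {c} → parts c)) (mk↔ₛ′ to from to-from from-to))
  where
  Parts : Code n → Set
  Parts c = (Fin (F (fix false c)) ⊎ Fin (F (fix true c)))
    ⊎ (Σ (Fin n) (λ x → Fin (F (ins x false c))) ⊎ Σ (Fin n) (λ x → Fin (F (ins x true c))))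

  parts : ∀ c → Fin (extend F c) ↔ Parts c
  parts c = ↔-trans (+↔⊎ {F (fix false c) + F (fix true c)})
    (+↔⊎ {F (fix false c)} ⊎-↔ ↔-trans (+↔⊎ {sum (λ x → F (ins x false c))})
      (Fin-sum-↔ (λ x → F (ins x false c)) ⊎-↔ Fin-sum-↔ (λ x → F (ins x true c))))

  to : Σ (Code n) Parts → Σ (Code (suc n)) (Fin ∘ F)
  to (c , inj₁ (inj₁ a))       = fix false c , a
  to (c , inj₁ (inj₂ a))       = fix true c , a
  to (c , inj₂ (inj₁ (x , a))) = ins x false c , a
  to (c , inj₂ (inj₂ (x , a))) = ins x true c , a
  from : Σ (Code (suc n)) (Fin ∘ F) → Σ (Code n) Parts
  from (fix false c   , a) = c , inj₁ (inj₁ a)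
  from (fix true c    , a) = c , inj₁ (inj₂ a)
  from (ins x false c , a) = c , inj₂ (inj₁ (x , a))
  from (ins x true c  , a) = c , inj₂ (inj₂ (x , a))
  to-from : ∀ y → to (from y) ≡ y
  to-from (fix false c   , a) = refl
  to-from (fix true c    , a) = refl
  to-from (ins x false c , a) = refl
  to-from (ins x true c  , a) = refl
  from-to : ∀ y → from (to y) ≡ y
  from-to (c , inj₁ (inj₁ a)) = refl
  from-to (c , inj₁ (inj₂ a)) = refl
  from-to (c , inj₂ (inj₁ a)) = refl
  from-to (c , inj₂ (inj₂ a)) = refl

δ-refl : ∀ a → δ a a ≡ 1
δ-refl zero    = refl
δ-refl (suc a) = δ-refl a

δ-sound : ∀ a b → Fin (δ a b) → a ≡ b
δ-sound zero    zero    _ = refl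
δ-sound (suc a) (suc b) x = cong suc (δ-sound a b x)

point-refl : ∀ p i v d u → point p i v d u p i v d u ≡ 1
point-refl p i v d u rewrite δ-refl p | δ-refl i | δ-refl v | δ-refl d | δ-refl u = refl

-- An element of `Fin` of a product is a tuple of elements of the factors, and an element of
-- `Fin (δ a b)` is evidence that `a` equals `b`.
point-sound : ∀ p₀ i₀ v₀ d₀ u₀ p i v d u → Fin (point p₀ i₀ v₀ d₀ u₀ p i v d u) →
              p ≡ p₀ × i ≡ i₀ × v ≡ v₀ × d ≡ d₀ × u ≡ u₀
point-sound p₀ i₀ v₀ d₀ u₀ p i v d u x =
  let a , x = remQuot {δ p p₀} (δ i i₀ * (δ v v₀ * (δ d d₀ * δ u u₀))) x
      b , x = remQuot {δ i i₀} (δ v v₀ * (δ d d₀ * δ u u₀)) x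
      c , x = remQuot {δ v v₀} (δ d d₀ * δ u u₀) x
      d′ , e = remQuot {δ d d₀} (δ u u₀) x
  in δ-sound p p₀ a , δ-sound i i₀ b , δ-sound v v₀ c , δ-sound d d₀ d′ , δ-sound u u₀ e

Fin1-unique : ∀ {m} → m ≡ 1 → (x y : Fin m) → x ≡ y
Fin1-unique refl zero zero = refl

DerSet-≡ : ∀ {i j} {x y : DerSet n i j} → proj₁ x ≡ proj₁ y → x ≡ y
DerSet-≡ {x = π , p , q , r , s} {.π , p′ , q′ , r′ , s′} refl
  rewrite Decidable⇒UIP.≡-irrelevant Bool._≟_ p p′ | Decidable⇒UIP.≡-irrelevant ℤ._≟_ q q′ | Decidable⇒UIP.≡-irrelevant ℤ._≟_ r r′ | ℕ.≡-irrelevant s s′ = refl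

∧-true : ∀ {x y} → (x ∧ y) ≡ true → x ≡ true × y ≡ true
∧-true {true} eq = refl , eq

Stats : Code n → ℕ → ℕ → ℕ → Set
Stats c i j d = (# c) posFix ≡ 0 × (# c) negFix ≡ i × (# c) valley ≡ j × (# c) desc ≡ d × (# c) asc ≡ 0

code : ∀ {i j} → DerSet n i j → Code n
code (π , der , _) = proj₁ (encode (lookup π) (injective π (proj₁ (∧-true der))))

arr-code : ∀ {i j} (x : DerSet n i j) → arr (code x) ≡ proj₁ x
arr-code (π , der , _) = trans
  (tabulate-cong (proj₂ (encode (lookup π) (injective π (proj₁ (∧-true der)))))) (tabulate∘lookup π)

code-arr : ∀ {i j} (c : Code n) (x : DerSet n i j) → proj₁ x ≡ arr c → code x ≡ c
code-arr c x eq = ent-injective (code x) c λ h → begin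
  ent (code x) h           ≡⟨ lookup∘tabulate (ent (code x)) h ⟨
  lookup (arr (code x)) h  ≡⟨ cong (λ π → lookup π h) (trans (arr-code x) eq) ⟩
  lookup (arr c) h         ≡⟨ lookup∘tabulate (ent c) h ⟩
  ent c h                  ∎
  where open ≡-Reasoning

-- `DerSet` does not prescribe the number of double descents, but `point` does. The count of all `n`
-- nodes, with as many peaks as valleys, makes it n - i - 2j.
stats : ∀ {i j} (x : DerSet n i j) → ∃ λ i₀ → ∃ λ j₀ → ∃ λ d →
        i ≡ + i₀ × j ≡ + j₀ × i₀ + 2 * j₀ + d ≡ n × Stats (code x) i₀ j₀ d
stats {n} x@(π , der , single≡ , wexc≡ , cda≡) =
  (# c) negFix , (# c) valley , (# c) desc ,
  trans (sym single≡) (cong +_ (trans (cong single (sym (arr-code x))) (single-arr c))) ,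
  trans (sym wexc≡) (cong +_ (trans (cong wexc (sym (arr-code x)))
    (trans (wexc-arr c) (trans (cong (λ u → (# c) valley + u) no-asc) (ℕ.+-identityʳ _))))) ,
  total ,
  no-posFix , refl , refl , refl , no-asc
  where
  c = code x

  no-posFix : (# c) posFix ≡ 0
  no-posFix = derangement⇒ c (trans (cong isDerangement (arr-code x)) (proj₂ (∧-true der)))

  no-asc : (# c) asc ≡ 0
  no-asc = cda-arr⇒ c (trans (cong cda (arr-code x)) cda≡)

  total : (# c) negFix + 2 * (# c) valley + (# c) desc ≡ n
  total = begin
    (# c) negFix + 2 * (# c) valley + (# c) desc
      ≡⟨ regroup ((# c) negFix) ((# c) valley) ((# c) desc) ⟩
    0 + ((# c) negFix + ((# c) valley + ((# c) valley + ((# c) desc + 0))))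
      ≡⟨ cong₂ (λ p r → p + ((# c) negFix + ((# c) valley + r))) no-posFix
           (cong₂ (λ k u → k + ((# c) desc + u)) (peaks≡valleys c) no-asc) ⟨
    sumKind (# c)
      ≡⟨ count-total (kind c) ⟩
    n ∎
    where
    open ≡-Reasoning
    regroup : ∀ i v d → i + 2 * v + d ≡ 0 + (i + (v + (v + (d + 0))))
    regroup = solve-∀

derangement : ∀ {i j d} (c : Code n) → Stats c i j d → DerSet n (+ i) (+ j)
derangement c (p≡ , i≡ , v≡ , _ , u≡) =
  arr c ,
  cong₂ _∧_ (isBn-arr c) (⇒derangement c p≡) ,
  cong +_ (trans (single-arr c) i≡) ,
  cong +_ (trans (wexc-arr c) (trans (cong₂ _+_ v≡ u≡) (ℕ.+-identityʳ _))) ,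
  ⇒cda-arr c u≡

module _ {i j d : ℕ} (total : i + 2 * j + d ≡ n) where
  private
    F : Code n → ℕ
    F c = at# (point 0 i j d 0) (# c)

  point-complete : ∀ c → Stats c i j d → F c ≡ 1
  point-complete c (p≡ , i≡ , v≡ , d≡ , u≡) rewrite p≡ | i≡ | v≡ | d≡ | u≡ = point-refl 0 i j d 0

  stats-of : ∀ c → Fin (F c) → Stats c i j d
  stats-of c = point-sound 0 i j d 0 ((# c) posFix) ((# c) negFix) ((# c) valley) ((# c) desc) ((# c) asc)

  Stats-unique : ∀ {c : Code n} {i₀ j₀ d₀} → + i ≡ + i₀ → + j ≡ + j₀ → i₀ + 2 * j₀ + d₀ ≡ n →
                 Stats c i₀ j₀ d₀ → Stats c i j d
  Stats-unique {c} {d₀ = d₀} refl refl total₀ =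
    subst (Stats c i j) (ℕ.+-cancelˡ-≡ (i + 2 * j) d₀ d (trans total₀ (sym total)))

  code-stats : (x : DerSet n (+ i) (+ j)) → Stats (code x) i j d
  code-stats x = let _ , _ , _ , i≡ , j≡ , total₀ , st = stats x in Stats-unique {code x} i≡ j≡ total₀ st

  Stats-↔ : Σ (Code n) (Fin ∘ F) ↔ DerSet n (+ i) (+ j)
  Stats-↔ = mk↔ₛ′ to from (λ x → DerSet-≡ (arr-code x)) from-to
    where
    to : Σ (Code n) (Fin ∘ F) → DerSet n (+ i) (+ j)
    to (c , x) = derangement c (stats-of c x)

    from : DerSet n (+ i) (+ j) → Σ (Code n) (Fin ∘ F)
    from x = code x , subst Fin (sym (point-complete (code x) (code-stats x))) zero

    Σ-≡ : ∀ {c c′} (x : Fin (F c)) (x′ : Fin (F c′)) → c ≡ c′ → (c , x) ≡ (c′ , x′)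
    Σ-≡ {c} x x′ refl = cong (c ,_) (Fin1-unique (point-complete c (stats-of c x)) x x′)

    from-to : ∀ y → from (to y) ≡ y
    from-to (c , x) = Σ-≡ _ x (code-arr c (to (c , x)) refl)

  b-↔ : Fin (b n i j d) ↔ DerSet n (+ i) (+ j)
  b-↔ = subst (λ k → Fin k ↔ DerSet n (+ i) (+ j)) number≡b (↔-trans (Fin-sumCode-↔ F) Stats-↔)
    where
    number≡b : number n 0 i j d 0 ≡ b n i j d
    number≡b = begin
      number n 0 i j d 0                  ≡⟨ split-sum n 0 i j d 0 ⟩
      1 * (bin d 0 * b n i j (d + 0))     ≡⟨ ℕ.*-identityˡ _ ⟩
      bin d 0 * b n i j (d + 0)           ≡⟨ cong₂ (λ x y → x * b n i j y) (bin-0ʳ d) (ℕ.+-identityʳ d) ⟩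
      1 * b n i j d                       ≡⟨ ℕ.*-identityˡ _ ⟩
      b n i j d                           ∎
      where open ≡-Reasoning

empty-↔ : ∀ {A : Set} → ¬ A → Fin 0 ↔ A
empty-↔ ¬a = mk↔ₛ′ (λ ()) (⊥-elim ∘ ¬a) (λ a → ⊥-elim (¬a a)) (λ ())

DerSet-bound : ∀ {i j} → DerSet n (+ i) (+ j) → i + 2 * j ≤ n
DerSet-bound {n} x = let _ , _ , d , i≡ , j≡ , total , _ = stats x in bound d i≡ j≡ total
  where
  bound : ∀ {i j i₀ j₀} d → + i ≡ + i₀ → + j ≡ + j₀ → i₀ + 2 * j₀ + d ≡ n → i + 2 * j ≤ n
  bound {i} {j} d refl refl total = ℕ.≤-trans (ℕ.m≤m+n (i + 2 * j) d) (ℕ.≤-reflexive total)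

theorem6 : (n : ℕ) → 1 ≤ n → (i j : ℤ) →
    Σ ℕ (λ k → (g n i j ≡ + k) × (Fin k ↔ DerSet n i j))
theorem6 (suc n) _ (+ i) (+ j) with i + 2 * j ℕ.≤? suc n
... | yes le = b (suc n) i j d , g-value n i j d total , b-↔ total
  where
  -- The number of double descents forced by the size; the subtraction is exact by `le`.
  d = suc n ∸ (i + 2 * j)
  total : i + 2 * j + d ≡ suc n
  total = ℕ.m+[n∸m]≡n le
... | no ≰ = 0 , g-big n i j (ℕ.≰⇒> ≰) , empty-↔ (≰ ∘ DerSet-bound)
theorem6 (suc n) _ -[1+ i ] j = 0 , g-neg-i n i j , empty-↔ λ { (_ , _ , () , _) }
theorem6 (suc n) _ (+ i) -[1+ j ] = 0 , g-neg-j n (+ i) j , empty-↔ λ { (_ , _ , _ , () , _) }
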